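{- Work in the ring $\hat\Lambda=\mathbb{Q}[[p_1,p_2,\ldots]]$ of symmetric series, where $p_n$ is the $n$-th power sum symmetric function, equipped with the Kronecker product $\otimes$ defined on power sum products by $p_\lambda\otimes p_\mu=\delta_{\lambda\mu}z_\lambda p_\lambda$ and extended bilinearly (degree by degree) to $\hat\Lambda$. Define \[ \mathsf{H}=\sum_{n\ge0}h_n=\exp\Big(\sum_{n\ge1}\frac{p_n}{n}\Big),\qquad \mathsf{E}=\sum_{n\ge0}e_n=\exp\Big(\sum_{n\ge1}(-1)^{n+1}\frac{p_n}{n}\Big), \] \[ \mathsf{S}=\sum_{\lambda}s_\lambda=\exp\Big(\sum_{n\ge1}\Big(\frac{p_n^2}{2n}+\frac{p_{2n-1}}{2n-1}\Big)\Big), \] (the sum over all partitions $\lambda$, including the empty one), and the products $\mathsf{S}\mathsf{H}^{ -1}$ and $\mathsf{S}\mathsf{E}^{ -1}$ in $\hat\Lambda$. Further define \[ \mathsf{M}_{odd}=\exp\Big(\sum_{n\ \mathrm{odd}}\frac{p_n}{n(1-p_n)}\Big),\quad \mathsf{M}_{even}=\exp\Big(\sum_{n\ \mathrm{even}}\frac{p_n}{n(1-p_n)}\Big),\quad \mathsf{N}=\exp\Big(\sum_{n\ge1}\frac{p_n^2}{2n(1-p_n^2)}\Big), \] \[ \mathsf{P}=\exp\Big(-\sum_{n\ \mathrm{even}}\frac{p_n}{n(1+p_n)}\Big),\qquad \mathsf{G}=\prod_{n\ge1}(1-p_n^2)^{ -1/2}. \] Then the following Kronecker product identities hold (and, $\otimes$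 being commutative, also with the factors swapped): \begin{align*} &\mathsf{H}\otimes\mathsf{H}=\mathsf{H},\quad \mathsf{H}\otimes\mathsf{E}=\mathsf{E},\quad \mathsf{H}\otimes\mathsf{S}=\mathsf{S},\quad \mathsf{H}\otimes\mathsf{S}\mathsf{H}^{ -1}=\mathsf{S}\mathsf{H}^{ -1},\quad \mathsf{H}\otimes\mathsf{S}\mathsf{E}^{ -1}=\mathsf{S}\mathsf{E}^{ -1},\\ &\mathsf{E}\otimes\mathsf{E}=\mathsf{H},\quad \mathsf{E}\otimes\mathsf{S}=\mathsf{S},\quad \mathsf{E}\otimes\mathsf{S}\mathsf{H}^{ -1}=\mathsf{S}\mathsf{E}^{ -1},\quad \mathsf{E}\otimes\mathsf{S}\mathsf{E}^{ -1}=\mathsf{S}\mathsf{H}^{ -1},\\ &\mathsf{S}\otimes\mathsf{S}=\mathsf{G}\,\mathsf{M}_{odd},\quad \mathsf{S}\otimes\mathsf{S}\mathsf{H}^{ -1}=\mathsf{G}\,\mathsf{N},\quad \mathsf{S}\otimes\mathsf{S}\mathsf{E}^{ -1}=\mathsf{G}\,\mathsf{N},\\ &\mathsf{S}\mathsf{H}^{ -1}\otimes\mathsf{S}\mathsf{H}^{ -1}=\mathsf{G}\,\mathsf{M}_{even},\quad \mathsf{S}\mathsf{H}^{ -1}\otimes\mathsf{S}\mathsf{E}^{ -1}=\mathsf{G}\,\mathsf{P},\quad \mathsf{S}\mathsf{E}^{ -1}\otimes\mathsf{S}\mathsf{E}^{ -1}=\mathsf{G}\,\mathsf{M}_{even}.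 \end{align*}
   Context: $h_n$, $e_n$, $s_\lambda$ denote the complete, elementary and Schur symmetric functions; $p_\lambda=p_{\lambda_1}\cdots p_{\lambda_k}$; for $\lambda=[1^{r_1}2^{r_2}\cdots]$ (i.e. $\lambda$ has $r_i$ parts equal to $i$), $z_\lambda=\prod_i i^{r_i}r_i!$. All exponentials, inverses and the product defining $\mathsf{G}$ are taken as formal power series in $\hat\Lambda$, where $(1-p_n^2)^{ -1/2}=\sum_{k\ge0}\binom{2k}{k}4^{ -k}p_n^{2k}$. -}

module Defs where

open import Data.Nat using (ℕ; zero; suc; _∸_; _!; _^_) renaming (_+_ to _+ℕ_; _*_ to _*ℕ_)
open import Data.Nat.Combinatorics using (_C_)
open import Data.Bool using (Bool; true; false; if_then_else_; _∧_)
open import Data.List using (List; []; _∷_; concatMap; map; upTo)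
open import Data.Product using (_×_; _,_)
open import Data.Integer using (+_)
open import Data.Rational using (ℚ; 0ℚ; 1ℚ; _+_; _*_; -_; _-_; _/_)
open import Relation.Binary.PropositionalEquality using (_≡_)

-- Monomials in the power sums p₁, p₂, … :
-- a list (r₁ ∷ r₂ ∷ … ∷ r_L ∷ []) stands for p₁^r₁ p₂^r₂ ⋯ p_L^r_L,
-- i.e. the partition λ = [1^r₁ 2^r₂ ⋯]; missing (trailing) entries are 0.
Mono : Set
Mono = List ℕ

-- A symmetric series in Λ̂ = ℚ[[p₁,p₂,…]]: its coefficient of every p_λ.
Series : Set
Series = Mono → ℚ

_≈S_ : Series → Series → Set
f ≈S g = ∀ r → f r ≡ g r
infix 4 _≈S_

fromℕ : ℕ → ℚ
fromℕ n = + n / 1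

-- 1/n for n ≥ 1 (only ever used at nonzero arguments)
recip : ℕ → ℚ
recip zero    = 0ℚ
recip (suc n) = + 1 / suc n

sumTo : ℕ → (ℕ → ℚ) → ℚ
sumTo zero    f = f 0
sumTo (suc n) f = sumTo n f + f (suc n)

sum1To : ℕ → (ℕ → ℚ) → ℚ
sum1To zero    f = 0ℚ
sum1To (suc n) f = sum1To n f + f (suc n)

sumList : List ℚ → ℚ
sumList []       = 0ℚ
sumList (x ∷ xs) = x + sumList xs

wdeg′ : ℕ → Mono → ℕ
wdeg′ i []       = 0
wdeg′ i (a ∷ r) = i *ℕ a +ℕ wdeg′ (suc i) r

wdeg : Mono → ℕ
wdeg = wdeg′ 1

zλ′ : ℕ → Mono → ℕ
zλ′ i []       = 1
zλ′ i (a ∷ r) = (i ^ a) *ℕ (a !) *ℕ zλ′ (suc i) r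

zλ : Mono → ℕ
zλ = zλ′ 1

isZeroMono : Mono → Bool
isZeroMono []            = true
isZeroMono (zero ∷ r)    = isZeroMono r
isZeroMono (suc _ ∷ r)   = false

-- is the monomial exactly p_{j+1} (0-based position j)?
isVar : ℕ → Mono → Bool
isVar j       []                  = false
isVar zero    (1 ∷ r)             = isZeroMono r
isVar zero    (_ ∷ r)             = false
isVar (suc j) (zero ∷ r)          = isVar j r
isVar (suc j) (suc _ ∷ r)         = false

splits : Mono → List (Mono × Mono)
splits []       = ([] , []) ∷ []
splits (a ∷ r) =
  concatMap (λ i → map (λ { (s , t) → (i ∷ s , (a ∸ i) ∷ t) }) (splits r))
            (upTo (suc a))

zeroS : Series
zeroS _ = 0ℚ

oneS : Series
oneS r = if isZeroMono r then 1ℚ else 0ℚ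

_+S_ : Series → Series → Series
(f +S g) r = f r + g r

negS : Series → Series
negS f r = - f r

_-S_ : Series → Series → Series
(f -S g) r = f r - g r

scaleS : ℚ → Series → Series
scaleS c f r = c * f r

_*S_ : Series → Series → Series
(f *S g) r = sumList (map (λ { (s , t) → f s * g t }) (splits r))

infixl 6 _+S_ _-S_
infixl 7 _*S_

powS : Series → ℕ → Series
powS f zero    = oneS
powS f (suc k) = f *S powS f k

-- the power sum p_n (n ≥ 1); p₀ is not used and set to 0
p : ℕ → Series
p zero    r = 0ℚ
p (suc m) r = if isVar m r then 1ℚ else 0ℚ

-- formal exponential, inverse, infinite sums and products.
-- The truncations below are exact: a power f^k of a series with zero
-- constant term only has monomials of weighted degree ≥ k, etc.

-- exp f = Σ_{k≥0} f^k / k!   (for f with zero constant term)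
expS : Series → Series
expS f r = sumTo (wdeg r) (λ k → recip (k !) * powS f k r)

-- f⁻¹ = Σ_{k≥0} (1 - f)^k   (for f with constant term 1)
invS : Series → Series
invS f r = sumTo (wdeg r) (λ k → powS (oneS -S f) k r)

-- Σ_{n≥1} F n   (for families with F n of order ≥ n)
sumS : (ℕ → Series) → Series
sumS F r = sum1To (wdeg r) (λ n → F n r)

-- ∏_{n≥1} F n   (for families with F n - 1 of order ≥ n)
prodUpTo : ℕ → (ℕ → Series) → Series
prodUpTo zero    F = oneS
prodUpTo (suc n) F = prodUpTo n F *S F (suc n)

prodS : (ℕ → Series) → Series
prodS F r = prodUpTo (wdeg r) F r

-- Kronecker product: p_λ ⊗ p_μ = δ_{λμ} z_λ p_λ, extended bilinearly
_⊗_ : Series → Series → Series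
(f ⊗ g) r = fromℕ (zλ r) * (f r * g r)
infixl 5 _⊗_

odd : ℕ → Bool
odd zero          = false
odd (suc zero)    = true
odd (suc (suc n)) = odd n

even : ℕ → Bool
even n = if odd n then false else true

geomInv : Series → Series
geomInv x = invS (oneS -S x)

H : Series
H = expS (sumS (λ n → scaleS (recip n) (p n)))

E : Series
E = expS (sumS (λ n → scaleS ((if odd n then 1ℚ else - 1ℚ) * recip n) (p n)))

S : Series
S = expS (sumS (λ n → scaleS (recip (2 *ℕ n)) (powS (p n) 2)
                    +S scaleS (recip (2 *ℕ n ∸ 1)) (p (2 *ℕ n ∸ 1))))

SH⁻¹ : Series
SH⁻¹ = S *S invS H

SE⁻¹ : Series
SE⁻¹ = S *S invS E

pTerm : ℕ → Series
pTerm n = scaleS (recip n) (p n *S geomInv (p n))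

Modd : Series
Modd = expS (sumS (λ n → if odd n then pTerm n else zeroS))

Meven : Series
Meven = expS (sumS (λ n → if even n then pTerm n else zeroS))

N : Series
N = expS (sumS (λ n → scaleS (recip (2 *ℕ n))
                          (powS (p n) 2 *S geomInv (powS (p n) 2))))

P : Series
P = expS (negS (sumS (λ n → if even n
                              then scaleS (recip n) (p n *S invS (oneS +S p n))
                              else zeroS)))

-- (1 - p_n²)^{-1/2} = Σ_k binom(2k,k) 4^{-k} p_n^{2k}
invSqrt : ℕ → Series
invSqrt n r = sumTo (wdeg r)
  (λ k → fromℕ ((2 *ℕ k) C k) * recip (4 ^ k) * powS (p n) (2 *ℕ k) r)

G : Series
G = prodS invSqrt

{-# OPTIONS --safe #-}

-- Since z_λ is a product over the variables p_n, the Kronecker product of two series that factor as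
-- ∏ c_n(p_n) factors in the same way, and each identity becomes one about one-variable series.
-- The factors are exp(s x/n) for H and E, and exp(x²/2n + a x/n) for S, S H⁻¹ and S E⁻¹, where s and a
-- depend only on the parity of n; the product of two of the latter is given by Mehler's formula
--   (1-x²)^{-1/2} exp((a b x + (a² + b²) x²/2) / (n (1-x²))).
-- Exponentials, in one or all variables, are identified by uniqueness of the solution of D f = φ f with
-- f = 1 in degree 0, where D multiplies a monomial of degree d (each p_n having degree 1) by d.
module Submission where

open import Defs
open import Algebra.Bundles using (CommutativeSemiring)
open import Algebra.Structures using (IsCommutativeSemiring; module IsCommutativeRing)
import Algebra.Solver.Ring.NaturalCoefficients.Default as SemiringSolver
open import Data.Bool using (Bool; true; false; if_then_else_)
open import Data.Integer as ℤ using ()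
import Data.Integer.Properties as ℤ
open import Data.List using (List; []; _∷_; _++_; map; concatMap; applyUpTo)
open import Data.List.Properties using (map-++; map-∘)
open import Data.Nat as ℕ using (ℕ; zero; suc; _≤_; _<_; z≤n; s≤s; NonZero; _!; _^_; _∸_)
import Data.Nat.DivMod as ℕ
import Data.Nat.Properties as ℕ
import Data.Nat.Solver
open import Data.Product using (_×_; _,_)
open import Data.Sum using (inj₁; inj₂)
open import Function using (_∘_; id)
open import Level using (0ℓ)
open import Relation.Nullary using (contradiction)
open import Relation.Binary.PropositionalEquality
open ≡-Reasoning

-- Giving every p_n the degree 1 makes D restrict to x d/dx in each variable, whatever n is, and
-- still multiply by a positive integer outside degree 0, which can be cancelled.
--
-- The obstacle is Mehler's formula. The coefficients of exp(x²/2n + a x/n), up to the weight 1/(n^r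
-- r!), obey a two-term Hermite recursion, but the termwise product of two such sequences obeys no
-- such recursion by itself. Two auxiliary series, with one of the two indices raised by one, close
-- the system; they turn out to be rational multiples of the product, and this is where the
-- denominator 1 - x² comes from.
--
-- Two details of the encoding shape the statements. Infinite sums and products are cut off at the
-- weighted degree, whereas the induction runs over the unweighted one. And a monomial has many
-- representations, differing by trailing zeros, so conditions in degree 0 are imposed on every list
-- of zeros and not only on the empty one.

deg : Mono → ℕ
deg []      = 0
deg (a ∷ r) = a ℕ.+ deg r

-- The algebra of series is developed over an abstract semiring rather than over ℚ because
-- Agda cannot invert the concrete operations of ℚ when it solves for implicit arguments.
module SeriesAlgebra
  {A : Set} {plus times : A → A → A} {0# 1# : A}
  (isCommutativeSemiring : IsCommutativeSemiring _≡_ plus times 0# 1#)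
  (fromℕ : ℕ → A)
  (fromℕ-zero : fromℕ 0 ≡ 0#)
  (fromℕ-suc : ∀ n → fromℕ (suc n) ≡ plus 1# (fromℕ n))
  (*-cancelˡ : ∀ n {x y} → times (fromℕ (suc n)) x ≡ times (fromℕ (suc n)) y → x ≡ y)
  where

  open IsCommutativeSemiring isCommutativeSemiring
    using (+-identityˡ; +-identityʳ; +-assoc; +-comm; *-identityˡ; *-identityʳ;
           *-assoc; *-comm; distribˡ; distribʳ; zeroˡ; zeroʳ)

  commutativeSemiring : CommutativeSemiring 0ℓ 0ℓ
  commutativeSemiring = record { isCommutativeSemiring = isCommutativeSemiring }

  open SemiringSolver commutativeSemiring

  infixl 6 _+_
  infixl 7 _*_ _⋆_ _⊛_
  infix 4 _≈_

  _+_ _*_ : A → A → A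
  _+_ = plus
  _*_ = times

  fromℕ-+ : ∀ m n → fromℕ (m ℕ.+ n) ≡ fromℕ m + fromℕ n
  fromℕ-+ zero    n = sym (trans (cong (_+ fromℕ n) fromℕ-zero) (+-identityˡ _))
  fromℕ-+ (suc m) n = begin
    fromℕ (suc (m ℕ.+ n))      ≡⟨ fromℕ-suc _ ⟩
    1# + fromℕ (m ℕ.+ n)       ≡⟨ cong (1# +_) (fromℕ-+ m n) ⟩
    1# + (fromℕ m + fromℕ n)   ≡⟨ +-assoc _ _ _ ⟨
    1# + fromℕ m + fromℕ n     ≡⟨ cong (_+ fromℕ n) (fromℕ-suc m) ⟨
    fromℕ (suc m) + fromℕ n    ∎

  +-congˡ : ∀ {x y z} → y ≡ z → x + y ≡ x + z
  +-congˡ eq = cong₂ _+_ refl eq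

  +-congʳ : ∀ {x y z} → x ≡ y → x + z ≡ y + z
  +-congʳ eq = cong₂ _+_ eq refl

  *-congˡ : ∀ {x y z} → y ≡ z → x * y ≡ x * z
  *-congˡ eq = cong₂ _*_ refl eq

  +-interchange : ∀ a b c d → (a + b) + (c + d) ≡ (a + c) + (b + d)
  +-interchange = solve 4 (λ a b c d → (a :+ b) :+ (c :+ d) := (a :+ c) :+ (b :+ d)) refl

  *-interchange : ∀ a b c d → (a * b) * (c * d) ≡ (a * c) * (b * d)
  *-interchange = solve 4 (λ a b c d → (a :* b) :* (c :* d) := (a :* c) :* (b :* d)) refl

  -- Sums over the splittings of an exponent and of a monomial

  -- Passing both parts of the splitting to `F` avoids truncated subtraction and lets the recursion
  -- shift the first index alone.
  Σℕ : (ℕ → ℕ → A) → ℕ → A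
  Σℕ F zero    = F 0 0
  Σℕ F (suc a) = F 0 (suc a) + Σℕ (λ i j → F (suc i) j) a

  Σℕ-cong : ∀ a {F G} → (∀ i j → i ℕ.+ j ≡ a → F i j ≡ G i j) → Σℕ F a ≡ Σℕ G a
  Σℕ-cong zero    eq = eq 0 0 refl
  Σℕ-cong (suc a) eq = cong₂ _+_ (eq 0 (suc a) refl) (Σℕ-cong a (λ i j e → eq (suc i) j (cong suc e)))

  Σℕ-ext : ∀ a {F G} → (∀ i j → F i j ≡ G i j) → Σℕ F a ≡ Σℕ G a
  Σℕ-ext a eq = Σℕ-cong a (λ i j _ → eq i j)

  Σℕ-+ : ∀ a {F G} → Σℕ (λ i j → F i j + G i j) a ≡ Σℕ F a + Σℕ G a
  Σℕ-+ zero    = refl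
  Σℕ-+ (suc a) = trans (+-congˡ (Σℕ-+ a)) (+-interchange _ _ _ _)

  Σℕ-*ˡ : ∀ a {k F} → Σℕ (λ i j → k * F i j) a ≡ k * Σℕ F a
  Σℕ-*ˡ zero    = refl
  Σℕ-*ˡ (suc a) = trans (+-congˡ (Σℕ-*ˡ a)) (sym (distribˡ _ _ _))

  Σℕ-*ʳ : ∀ a {k F} → Σℕ (λ i j → F i j * k) a ≡ Σℕ F a * k
  Σℕ-*ʳ zero    = refl
  Σℕ-*ʳ (suc a) = trans (+-congˡ (Σℕ-*ʳ a)) (sym (distribʳ _ _ _))

  Σℕ-zero : ∀ a → Σℕ (λ _ _ → 0#) a ≡ 0#
  Σℕ-zero zero    = refl
  Σℕ-zero (suc a) = trans (+-identityˡ _) (Σℕ-zero a)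

  Σℕ-last : ∀ a F → Σℕ F (suc a) ≡ Σℕ (λ i j → F i (suc j)) a + F (suc a) 0
  Σℕ-last zero    F = refl
  Σℕ-last (suc a) F = trans (+-congˡ (Σℕ-last a (F ∘ suc))) (sym (+-assoc _ _ _))

  Σℕ-comm : ∀ a F → Σℕ F a ≡ Σℕ (λ i j → F j i) a
  Σℕ-comm zero    F = refl
  Σℕ-comm (suc a) F = trans (+-congˡ (Σℕ-comm a (F ∘ suc)))
    (trans (+-comm _ _) (sym (Σℕ-last a (λ i j → F j i))))

  -- The triples with i + j + l = a, grouped from the right and from the left; this becomes
  -- associativity of the product.
  Σℕ-assoc : ∀ a (F : ℕ → ℕ → ℕ → A) →
    Σℕ (λ i k → Σℕ (λ j l → F i j l) k) a ≡ Σℕ (λ k l → Σℕ (λ i j → F i j l) k) a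
  Σℕ-assoc zero    F = refl
  Σℕ-assoc (suc a) F = begin
    (F 0 0 (suc a) + Σℕ (λ j → F 0 (suc j)) a) + Σℕ (λ i k → Σℕ (F (suc i)) k) a
      ≡⟨ +-congˡ (Σℕ-assoc a (λ i → F (suc i))) ⟩
    (F 0 0 (suc a) + Σℕ (λ j → F 0 (suc j)) a) + Σℕ (λ k l → Σℕ (λ i j → F (suc i) j l) k) a
      ≡⟨ +-assoc _ _ _ ⟩
    F 0 0 (suc a) + (Σℕ (λ j → F 0 (suc j)) a + Σℕ (λ k l → Σℕ (λ i j → F (suc i) j l) k) a)
      ≡⟨ cong (F 0 0 (suc a) +_) (Σℕ-+ a) ⟨
    F 0 0 (suc a) + Σℕ (λ k l → F 0 (suc k) l + Σℕ (λ i j → F (suc i) j l) k) a ∎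

  Σᴹ : (Mono → Mono → A) → Mono → A
  Σᴹ F []      = F [] []
  Σᴹ F (a ∷ r) = Σℕ (λ i j → Σᴹ (λ s t → F (i ∷ s) (j ∷ t)) r) a

  -- The degree constraint offered to the pointwise hypothesis is what later allows induction on the
  -- degree inside a product.
  Σᴹ-cong : ∀ r {F G} → (∀ s t → deg s ℕ.+ deg t ≡ deg r → F s t ≡ G s t) → Σᴹ F r ≡ Σᴹ G r
  Σᴹ-cong []      eq = eq [] [] refl
  Σᴹ-cong (a ∷ r) eq = Σℕ-cong a (λ i j e → Σᴹ-cong r (λ s t e′ → eq (i ∷ s) (j ∷ t)
    (trans (ℕ-interchange i (deg s) j (deg t)) (cong₂ ℕ._+_ e e′))))
    where
    open import Algebra.Properties.CommutativeSemigroup ℕ.+-commutativeSemigroup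
      using () renaming (interchange to ℕ-interchange)

  Σᴹ-ext : ∀ r {F G} → (∀ s t → F s t ≡ G s t) → Σᴹ F r ≡ Σᴹ G r
  Σᴹ-ext r eq = Σᴹ-cong r (λ s t _ → eq s t)

  Σᴹ-+ : ∀ r {F G} → Σᴹ (λ s t → F s t + G s t) r ≡ Σᴹ F r + Σᴹ G r
  Σᴹ-+ []      = refl
  Σᴹ-+ (a ∷ r) = trans (Σℕ-ext a (λ i j → Σᴹ-+ r)) (Σℕ-+ a)

  Σᴹ-*ˡ : ∀ r {k F} → Σᴹ (λ s t → k * F s t) r ≡ k * Σᴹ F r
  Σᴹ-*ˡ []      = refl
  Σᴹ-*ˡ (a ∷ r) = trans (Σℕ-ext a (λ i j → Σᴹ-*ˡ r)) (Σℕ-*ˡ a)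

  Σᴹ-*ʳ : ∀ r {k F} → Σᴹ (λ s t → F s t * k) r ≡ Σᴹ F r * k
  Σᴹ-*ʳ []      = refl
  Σᴹ-*ʳ (a ∷ r) = trans (Σℕ-ext a (λ i j → Σᴹ-*ʳ r)) (Σℕ-*ʳ a)

  Σᴹ-zero : ∀ r → Σᴹ (λ _ _ → 0#) r ≡ 0#
  Σᴹ-zero []      = refl
  Σᴹ-zero (a ∷ r) = trans (Σℕ-ext a (λ _ _ → Σᴹ-zero r)) (Σℕ-zero a)

  Σᴹ-comm : ∀ r {F} → Σᴹ F r ≡ Σᴹ (λ s t → F t s) r
  Σᴹ-comm []      = refl
  Σᴹ-comm (a ∷ r) = trans (Σℕ-ext a (λ i j → Σᴹ-comm r)) (Σℕ-comm a _)

  Σᴹ-Σℕ : ∀ r a {F : Mono → Mono → ℕ → ℕ → A} →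
    Σᴹ (λ s t → Σℕ (F s t) a) r ≡ Σℕ (λ i j → Σᴹ (λ s t → F s t i j) r) a
  Σᴹ-Σℕ r zero    = refl
  Σᴹ-Σℕ r (suc a) = trans (Σᴹ-+ r) (+-congˡ (Σᴹ-Σℕ r a))

  Σᴹ-assoc : ∀ r (F : Mono → Mono → Mono → A) →
    Σᴹ (λ s u → Σᴹ (λ t v → F s t v) u) r ≡ Σᴹ (λ u v → Σᴹ (λ s t → F s t v) u) r
  Σᴹ-assoc []      F = refl
  Σᴹ-assoc (a ∷ r) F = begin
    Σℕ (λ i k → Σᴹ (λ s u → Σℕ (λ j l → Σᴹ (λ t v → F (i ∷ s) (j ∷ t) (l ∷ v)) u) k) r) a
      ≡⟨ Σℕ-ext a (λ i k → Σᴹ-Σℕ r k) ⟩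
    Σℕ (λ i k → Σℕ (λ j l → Σᴹ (λ s u → Σᴹ (λ t v → F (i ∷ s) (j ∷ t) (l ∷ v)) u) r) k) a
      ≡⟨ Σℕ-ext a (λ i k → Σℕ-ext k (λ j l → Σᴹ-assoc r _)) ⟩
    Σℕ (λ i k → Σℕ (λ j l → Σᴹ (λ u v → Σᴹ (λ s t → F (i ∷ s) (j ∷ t) (l ∷ v)) u) r) k) a
      ≡⟨ Σℕ-assoc a _ ⟩
    Σℕ (λ k l → Σℕ (λ i j → Σᴹ (λ u v → Σᴹ (λ s t → F (i ∷ s) (j ∷ t) (l ∷ v)) u) r) k) a
      ≡⟨ Σℕ-ext a (λ k l → Σᴹ-Σℕ r k) ⟨
    Σℕ (λ k l → Σᴹ (λ u v → Σℕ (λ i j → Σᴹ (λ s t → F (i ∷ s) (j ∷ t) (l ∷ v)) u) k) r) a ∎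

  -- Products of series

  _≈_ : (Mono → A) → (Mono → A) → Set
  f ≈ g = ∀ r → f r ≡ g r

  _⋆_ : (ℕ → A) → (ℕ → A) → ℕ → A
  (c ⋆ d) a = Σℕ (λ i j → c i * d j) a

  _⊛_ : (Mono → A) → (Mono → A) → Mono → A
  (f ⊛ g) r = Σᴹ (λ s t → f s * g t) r

  _⊕_ : (Mono → A) → (Mono → A) → Mono → A
  (f ⊕ g) r = f r + g r

  δ : ℕ → A
  δ zero    = 1#
  δ (suc _) = 0#

  one : Mono → A
  one r = if isZeroMono r then 1# else 0#

  one-∷ : ∀ a r → one (a ∷ r) ≡ δ a * one r
  one-∷ zero    r = sym (*-identityˡ _)
  one-∷ (suc a) r = sym (zeroˡ _)

  one-deg0 : ∀ r → deg r ≡ 0 → one r ≡ 1#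
  one-deg0 []         _ = refl
  one-deg0 (zero ∷ r) e = one-deg0 r e

  Σℕ-δ : ∀ a (k : ℕ → A) → Σℕ (λ i j → δ i * k j) a ≡ k a
  Σℕ-δ zero    k = *-identityˡ _
  Σℕ-δ (suc a) k = begin
    1# * k (suc a) + Σℕ (λ i j → 0# * k j) a ≡⟨ cong₂ _+_ (*-identityˡ _) (Σℕ-ext a (λ _ _ → zeroˡ _)) ⟩
    k (suc a) + Σℕ (λ i j → 0#) a            ≡⟨ +-congˡ (Σℕ-zero a) ⟩
    k (suc a) + 0#                           ≡⟨ +-identityʳ _ ⟩
    k (suc a)                                ∎

  ⋆-comm : ∀ c d a → (c ⋆ d) a ≡ (d ⋆ c) a
  ⋆-comm c d a = trans (Σℕ-comm a _) (Σℕ-ext a (λ _ _ → *-comm _ _))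

  ⊛-cong : ∀ {f f′ g g′} → f ≈ f′ → g ≈ g′ → f ⊛ g ≈ f′ ⊛ g′
  ⊛-cong ef eg r = Σᴹ-ext r (λ s t → cong₂ _*_ (ef s) (eg t))

  ⊛-comm : ∀ f g → f ⊛ g ≈ g ⊛ f
  ⊛-comm f g r = trans (Σᴹ-comm r) (Σᴹ-ext r (λ _ _ → *-comm _ _))

  ⊛-assoc : ∀ f g h → (f ⊛ g) ⊛ h ≈ f ⊛ (g ⊛ h)
  ⊛-assoc f g h r = begin
    Σᴹ (λ u v → Σᴹ (λ s t → f s * g t) u * h v) r     ≡⟨ Σᴹ-ext r (λ u v → Σᴹ-*ʳ u) ⟨
    Σᴹ (λ u v → Σᴹ (λ s t → f s * g t * h v) u) r     ≡⟨ Σᴹ-assoc r _ ⟨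
    Σᴹ (λ s u → Σᴹ (λ t v → f s * g t * h v) u) r     ≡⟨ Σᴹ-ext r (λ s u → Σᴹ-ext u (λ _ _ → *-assoc _ _ _)) ⟩
    Σᴹ (λ s u → Σᴹ (λ t v → f s * (g t * h v)) u) r   ≡⟨ Σᴹ-ext r (λ s u → Σᴹ-*ˡ u) ⟩
    Σᴹ (λ s u → f s * Σᴹ (λ t v → g t * h v) u) r     ∎

  ⊛-leftComm : ∀ f g h → f ⊛ (g ⊛ h) ≈ g ⊛ (f ⊛ h)
  ⊛-leftComm f g h r = begin
    (f ⊛ (g ⊛ h)) r ≡⟨ ⊛-assoc f g h r ⟨
    ((f ⊛ g) ⊛ h) r ≡⟨ ⊛-cong (⊛-comm f g) (λ _ → refl) r ⟩
    ((g ⊛ f) ⊛ h) r ≡⟨ ⊛-assoc g f h r ⟩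
    (g ⊛ (f ⊛ h)) r ∎

  ⊛-distribʳ : ∀ f g h → (f ⊕ g) ⊛ h ≈ (f ⊛ h) ⊕ (g ⊛ h)
  ⊛-distribʳ f g h r = trans (Σᴹ-ext r (λ _ _ → distribʳ _ _ _)) (Σᴹ-+ r)

  ⊛-identityˡ : ∀ f → one ⊛ f ≈ f
  ⊛-identityˡ f []      = *-identityˡ _
  ⊛-identityˡ f (a ∷ r) = begin
    Σℕ (λ i j → Σᴹ (λ s t → one (i ∷ s) * f (j ∷ t)) r) a
      ≡⟨ Σℕ-ext a (λ i j → Σᴹ-ext r (λ s t → trans (cong (_* f (j ∷ t)) (one-∷ i s)) (*-assoc _ _ _))) ⟩
    Σℕ (λ i j → Σᴹ (λ s t → δ i * (one s * f (j ∷ t))) r) a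
      ≡⟨ Σℕ-ext a (λ i j → trans (Σᴹ-*ˡ r) (cong (δ i *_) (⊛-identityˡ (λ t → f (j ∷ t)) r))) ⟩
    Σℕ (λ i j → δ i * f (j ∷ r)) a
      ≡⟨ Σℕ-δ a _ ⟩
    f (a ∷ r) ∎

  ⊛-identityʳ : ∀ f → f ⊛ one ≈ f
  ⊛-identityʳ f r = trans (⊛-comm f one r) (⊛-identityˡ f r)

  ⊛-∷ : ∀ f g {f′ g′ c d} → (∀ i s → f (i ∷ s) ≡ c i * f′ s) → (∀ j t → g (j ∷ t) ≡ d j * g′ t) →
    ∀ a r → (f ⊛ g) (a ∷ r) ≡ (c ⋆ d) a * (f′ ⊛ g′) r
  ⊛-∷ f g {f′} {g′} {c} {d} ef eg a r = begin
    Σℕ (λ i j → Σᴹ (λ s t → f (i ∷ s) * g (j ∷ t)) r) a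
      ≡⟨ Σℕ-ext a (λ i j → Σᴹ-ext r (λ s t → trans (cong₂ _*_ (ef i s) (eg j t)) (*-interchange _ _ _ _))) ⟩
    Σℕ (λ i j → Σᴹ (λ s t → (c i * d j) * (f′ s * g′ t)) r) a
      ≡⟨ Σℕ-ext a (λ i j → Σᴹ-*ˡ r) ⟩
    Σℕ (λ i j → (c i * d j) * (f′ ⊛ g′) r) a
      ≡⟨ Σℕ-*ʳ a ⟩
    (c ⋆ d) a * (f′ ⊛ g′) r ∎

  -- The operator D and uniqueness for D f = φ f

  Vanishing : (Mono → A) → Set
  Vanishing φ = ∀ r → deg r ≡ 0 → φ r ≡ 0#

  Unital : (Mono → A) → Set
  Unital f = ∀ r → deg r ≡ 0 → f r ≡ 1#

  -- Since `φ` has no term in degree 0, `(φ ⊛ f) r` involves `f` only in degrees below `deg r`, so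
  -- strong induction on the degree applies. It serves both differential equations and inverses.
  fixpoint-unique : ∀ {φ f g} → Vanishing φ →
    (∀ r → (φ ⊛ f) r ≡ (φ ⊛ g) r → f r ≡ g r) → f ≈ g
  fixpoint-unique {φ} {f} {g} φ0 step r = below (suc (deg r)) r ℕ.≤-refl
    where
    below : ∀ n r → deg r < n → f r ≡ g r
    below (suc n) r (s≤s r≤n) = step r (Σᴹ-cong r term)
      where
      term : ∀ s t → deg s ℕ.+ deg t ≡ deg r → φ s * f t ≡ φ s * g t
      term s t e with deg s in es
      ... | zero  = trans (cong (_* f t) (φ0 s es)) (trans (zeroˡ _)
                      (sym (trans (cong (_* g t) (φ0 s es)) (zeroˡ _))))
      ... | suc k = cong (φ s *_) (below n t (ℕ.<-≤-trans (s≤s (ℕ.m≤n+m (deg t) k))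
                      (ℕ.≤-trans (ℕ.≤-reflexive e) r≤n)))

  D : (Mono → A) → Mono → A
  D f r = fromℕ (deg r) * f r

  D-⊛ : ∀ f g → D (f ⊛ g) ≈ (D f ⊛ g) ⊕ (f ⊛ D g)
  D-⊛ f g r = begin
    fromℕ (deg r) * Σᴹ (λ s t → f s * g t) r
      ≡⟨ Σᴹ-*ˡ r ⟨
    Σᴹ (λ s t → fromℕ (deg r) * (f s * g t)) r
      ≡⟨ Σᴹ-cong r (λ s t e → cong (_* (f s * g t)) (trans (cong fromℕ (sym e)) (fromℕ-+ (deg s) (deg t)))) ⟩
    Σᴹ (λ s t → (fromℕ (deg s) + fromℕ (deg t)) * (f s * g t)) r
      ≡⟨ Σᴹ-ext r (λ s t → leibniz (fromℕ (deg s)) (fromℕ (deg t)) (f s) (g t)) ⟩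
    Σᴹ (λ s t → D f s * g t + f s * D g t) r
      ≡⟨ Σᴹ-+ r ⟩
    ((D f ⊛ g) ⊕ (f ⊛ D g)) r ∎
    where
    leibniz = solve 4 (λ m n x y → (m :+ n) :* (x :* y) := m :* x :* y :+ x :* (n :* y)) refl

  D-vanishing : ∀ f → Vanishing (D f)
  D-vanishing f r e = trans (cong (λ n → fromℕ n * f r) e) (trans (cong (_* f r) fromℕ-zero) (zeroˡ _))

  -- Here `φ` stands for D log f, expressed without a logarithm or a quotient.
  record IsLogDerivative (f φ : Mono → A) : Set where
    field
      unital    : Unital f
      vanishing : Vanishing φ
      equation  : D f ≈ φ ⊛ f

  module LD = IsLogDerivative

  -- In positive degree the integer `deg r` on the left of the equation cancels; in degree 0 both
  -- series are 1.
  logDerivative-unique : ∀ {f g φ ψ} → IsLogDerivative f φ → IsLogDerivative g ψ → φ ≈ ψ → f ≈ g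
  logDerivative-unique {f} {g} {φ} {ψ} F G φ≈ψ = fixpoint-unique (LD.vanishing F) step
    where
    step : ∀ r → (φ ⊛ f) r ≡ (φ ⊛ g) r → f r ≡ g r
    step r eq with deg r in er
    ... | zero  = trans (LD.unital F r er) (sym (LD.unital G r er))
    ... | suc n = *-cancelˡ n (begin
      fromℕ (suc n) * f r  ≡⟨ cong (λ d → fromℕ d * f r) er ⟨
      D f r                ≡⟨ LD.equation F r ⟩
      (φ ⊛ f) r            ≡⟨ eq ⟩
      (φ ⊛ g) r            ≡⟨ ⊛-cong φ≈ψ (λ _ → refl) r ⟩
      (ψ ⊛ g) r            ≡⟨ LD.equation G r ⟨
      D g r                ≡⟨ cong (λ d → fromℕ d * g r) er ⟩
      fromℕ (suc n) * g r  ∎)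

  logDerivative-cong : ∀ {f g φ ψ} → f ≈ g → φ ≈ ψ → IsLogDerivative f φ → IsLogDerivative g ψ
  logDerivative-cong f≈g φ≈ψ F = record
    { unital    = λ r e → trans (sym (f≈g r)) (LD.unital F r e)
    ; vanishing = λ r e → trans (sym (φ≈ψ r)) (LD.vanishing F r e)
    ; equation  = λ r → trans (cong (fromℕ (deg r) *_) (sym (f≈g r)))
                          (trans (LD.equation F r) (⊛-cong φ≈ψ f≈g r))
    }

  -- A monomial of degree 0 splits only into monomials of degree 0, where `f` may be replaced by
  -- `one`.
  ⊛-unital : ∀ {f g} → Unital f → Unital g → Unital (f ⊛ g)
  ⊛-unital {f} {g} f1 g1 r e = begin
    (f ⊛ g) r    ≡⟨ Σᴹ-cong r (λ s t e′ → cong (_* g t) (agree s (ℕ.m+n≡0⇒m≡0 (deg s) (trans e′ e)))) ⟩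
    (one ⊛ g) r  ≡⟨ ⊛-identityˡ g r ⟩
    g r          ≡⟨ g1 r e ⟩
    1#           ∎
    where
    agree : ∀ s → deg s ≡ 0 → f s ≡ one s
    agree s es = trans (f1 s es) (sym (one-deg0 s es))

  logDerivative-⊛ : ∀ {f g φ ψ} → IsLogDerivative f φ → IsLogDerivative g ψ → IsLogDerivative (f ⊛ g) (φ ⊕ ψ)
  logDerivative-⊛ {f} {g} {φ} {ψ} F G = record
    { unital    = ⊛-unital (LD.unital F) (LD.unital G)
    ; vanishing = λ r e → trans (cong₂ _+_ (LD.vanishing F r e) (LD.vanishing G r e)) (+-identityˡ 0#)
    ; equation  = λ r → begin
        D (f ⊛ g) r
          ≡⟨ D-⊛ f g r ⟩
        (D f ⊛ g) r + (f ⊛ D g) r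
          ≡⟨ cong₂ _+_ (⊛-cong (LD.equation F) (λ _ → refl) r) (⊛-cong (λ _ → refl) (LD.equation G) r) ⟩
        ((φ ⊛ f) ⊛ g) r + (f ⊛ (ψ ⊛ g)) r
          ≡⟨ cong₂ _+_ (⊛-assoc φ f g r) (⊛-leftComm f ψ g r) ⟩
        (φ ⊛ (f ⊛ g)) r + (ψ ⊛ (f ⊛ g)) r
          ≡⟨ ⊛-distribʳ φ ψ (f ⊛ g) r ⟨
        ((φ ⊕ ψ) ⊛ (f ⊛ g)) r ∎
    }

  -- Series that are products or sums over the variables

  -- c m is the factor in the variable p_{m+1}.
  factored : (ℕ → ℕ → A) → Mono → A
  factored c []      = 1#
  factored c (a ∷ r) = c 0 a * factored (c ∘ suc) r

  -- φ m is the summand in the variable p_{m+1}; it is meant to have no constant term.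
  separated : (ℕ → ℕ → A) → Mono → A
  separated φ []      = 0#
  separated φ (a ∷ r) = φ 0 a * one r + δ a * separated (φ ∘ suc) r

  factored-cong : ∀ {c d} → (∀ m a → c m a ≡ d m a) → factored c ≈ factored d
  factored-cong eq []      = refl
  factored-cong eq (a ∷ r) = cong₂ _*_ (eq 0 a) (factored-cong (eq ∘ suc) r)

  factored-* : ∀ c d r → factored c r * factored d r ≡ factored (λ m a → c m a * d m a) r
  factored-* c d []      = *-identityˡ 1#
  factored-* c d (a ∷ r) = trans (*-interchange _ _ _ _) (*-congˡ (factored-* (c ∘ suc) (d ∘ suc) r))

  factored-unital : ∀ c → (∀ m → c m 0 ≡ 1#) → Unital (factored c)
  factored-unital c c0 []         _ = refl
  factored-unital c c0 (zero ∷ r) e =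
    trans (cong₂ _*_ (c0 0) (factored-unital (c ∘ suc) (c0 ∘ suc) r e)) (*-identityˡ 1#)

  separated-cong : ∀ {φ ψ} → (∀ m a → φ m a ≡ ψ m a) → separated φ ≈ separated ψ
  separated-cong eq []      = refl
  separated-cong eq (a ∷ r) =
    cong₂ _+_ (cong (_* one r) (eq 0 a)) (cong (δ a *_) (separated-cong (eq ∘ suc) r))

  separated-⊕ : ∀ φ ψ → separated φ ⊕ separated ψ ≈ separated (λ m a → φ m a + ψ m a)
  separated-⊕ φ ψ []      = +-identityˡ 0#
  separated-⊕ φ ψ (a ∷ r) = trans
    (regroup (φ 0 a) (ψ 0 a) (one r) (δ a) (separated (φ ∘ suc) r) (separated (ψ ∘ suc) r))
    (cong (λ x → (φ 0 a + ψ 0 a) * one r + δ a * x) (separated-⊕ (φ ∘ suc) (ψ ∘ suc) r))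
    where
    regroup = solve 6 (λ x y o d u v → (x :* o :+ d :* u) :+ (y :* o :+ d :* v) :=
                (x :+ y) :* o :+ d :* (u :+ v)) refl

  separated-vanishing : ∀ φ → (∀ m → φ m 0 ≡ 0#) → Vanishing (separated φ)
  separated-vanishing φ φ0 []         _ = refl
  separated-vanishing φ φ0 (zero ∷ r) e = begin
    φ 0 0 * one r + 1# * separated (φ ∘ suc) r
      ≡⟨ cong₂ (λ x y → x * one r + 1# * y) (φ0 0) (separated-vanishing (φ ∘ suc) (φ0 ∘ suc) r e) ⟩
    0# * one r + 1# * 0#  ≡⟨ cong₂ _+_ (zeroˡ _) (zeroʳ _) ⟩
    0# + 0#               ≡⟨ +-identityˡ 0# ⟩
    0#                    ∎

  deg-one : ∀ r → D one r ≡ 0#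
  deg-one []          = D-vanishing one [] refl
  deg-one (zero ∷ r)  = deg-one r
  deg-one (suc a ∷ r) = zeroʳ _

  -- The operator x d/dx on coefficients.
  θ : (ℕ → A) → ℕ → A
  θ c a = fromℕ a * c a

  θδ : ∀ a → θ δ a ≡ 0#
  θδ zero    = trans (cong (_* 1#) fromℕ-zero) (zeroˡ _)
  θδ (suc a) = zeroʳ _

  -- Each summand involves one variable only, so its total degree is its degree in that variable:
  -- the mixed terms contain `D one` or `θ δ`, both zero.
  D-separated : ∀ φ → D (separated φ) ≈ separated (θ ∘ φ)
  D-separated φ []      = zeroʳ _
  D-separated φ (a ∷ r) = begin
    fromℕ (a ℕ.+ deg r) * (φ 0 a * one r + δ a * s)
      ≡⟨ cong (_* (φ 0 a * one r + δ a * s)) (fromℕ-+ a (deg r)) ⟩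
    (fromℕ a + fromℕ (deg r)) * (φ 0 a * one r + δ a * s)
      ≡⟨ expand (fromℕ a) (fromℕ (deg r)) (φ 0 a) (one r) (δ a) s ⟩
    θ (φ 0) a * one r + δ a * D (separated (φ ∘ suc)) r + (φ 0 a * D one r + θ δ a * s)
      ≡⟨ cong₂ (λ x y → θ (φ 0) a * one r + δ a * D (separated (φ ∘ suc)) r + (φ 0 a * x + y * s)) (deg-one r) (θδ a) ⟩
    θ (φ 0) a * one r + δ a * D (separated (φ ∘ suc)) r + (φ 0 a * 0# + 0# * s)
      ≡⟨ +-congˡ (trans (cong₂ _+_ (zeroʳ _) (zeroˡ _)) (+-identityˡ 0#)) ⟩
    θ (φ 0) a * one r + δ a * D (separated (φ ∘ suc)) r + 0#
      ≡⟨ +-identityʳ _ ⟩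
    θ (φ 0) a * one r + δ a * D (separated (φ ∘ suc)) r
      ≡⟨ cong (λ x → θ (φ 0) a * one r + δ a * x) (D-separated (φ ∘ suc) r) ⟩
    separated (θ ∘ φ) (a ∷ r) ∎
    where
    s = separated (φ ∘ suc) r
    expand = solve 6 (λ m n x o d u → (m :+ n) :* (x :* o :+ d :* u) :=
               m :* x :* o :+ d :* (n :* u) :+ (x :* (n :* o) :+ m :* d :* u)) refl

  factored-equation : ∀ c ψ → (∀ m a → θ (c m) a ≡ (ψ m ⋆ c m) a) →
    D (factored c) ≈ separated ψ ⊛ factored c
  factored-equation c ψ eq []      = trans (D-vanishing (factored c) [] refl) (sym (zeroˡ _))
  factored-equation c ψ eq (a ∷ r) = begin
    fromℕ (a ℕ.+ deg r) * (c 0 a * C r)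
      ≡⟨ cong (_* (c 0 a * C r)) (fromℕ-+ a (deg r)) ⟩
    (fromℕ a + fromℕ (deg r)) * (c 0 a * C r)
      ≡⟨ leibniz (fromℕ a) (fromℕ (deg r)) (c 0 a) (C r) ⟩
    θ (c 0) a * C r + c 0 a * D C r
      ≡⟨ cong₂ (λ x y → x * C r + c 0 a * y) (eq 0 a) (factored-equation (c ∘ suc) (ψ ∘ suc) (eq ∘ suc) r) ⟩
    (ψ 0 ⋆ c 0) a * C r + c 0 a * (Ψ ⊛ C) r
      -- The units `one` and `δ` are inserted so that each term is a product in the first variable
      -- times a product in the others.
      ≡⟨ cong₂ (λ x y → (ψ 0 ⋆ c 0) a * x + y * (Ψ ⊛ C) r) (⊛-identityˡ C r) (Σℕ-δ a (c 0)) ⟨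
    (ψ 0 ⋆ c 0) a * (one ⊛ C) r + (δ ⋆ c 0) a * (Ψ ⊛ C) r
      ≡⟨ cong₂ _+_ (⊛-∷ (tensor (ψ 0) one) (factored c) (λ _ _ → refl) (λ _ _ → refl) a r)
                    (⊛-∷ (tensor δ Ψ) (factored c) (λ _ _ → refl) (λ _ _ → refl) a r) ⟨
    (tensor (ψ 0) one ⊛ factored c) (a ∷ r) + (tensor δ Ψ ⊛ factored c) (a ∷ r)
      ≡⟨ ⊛-distribʳ (tensor (ψ 0) one) (tensor δ Ψ) (factored c) (a ∷ r) ⟨
    ((tensor (ψ 0) one ⊕ tensor δ Ψ) ⊛ factored c) (a ∷ r) ≡⟨⟩
    (separated ψ ⊛ factored c) (a ∷ r) ∎
    where
    C = factored (c ∘ suc)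
    Ψ = separated (ψ ∘ suc)
    tensor : (ℕ → A) → (Mono → A) → Mono → A
    tensor d f []      = 0#
    tensor d f (b ∷ s) = d b * f s
    leibniz = solve 4 (λ m n x y → (m :+ n) :* (x :* y) := m :* x :* y :+ x :* (n :* y)) refl

  record IsLogDerivative₁ (c ψ : ℕ → A) : Set where
    field
      unital   : c 0 ≡ 1#
      equation : ∀ a → θ c a ≡ (ψ ⋆ c) a

    vanishing : ψ 0 ≡ 0#
    vanishing = begin
      ψ 0            ≡⟨ *-identityʳ _ ⟨
      ψ 0 * 1#       ≡⟨ cong (ψ 0 *_) unital ⟨
      ψ 0 * c 0      ≡⟨ equation 0 ⟨
      fromℕ 0 * c 0  ≡⟨ cong (_* c 0) fromℕ-zero ⟩
      0# * c 0       ≡⟨ zeroˡ _ ⟩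
      0#             ∎

  logDerivative-factored : ∀ {c ψ} → (∀ m → IsLogDerivative₁ (c m) (ψ m)) →
    IsLogDerivative (factored c) (separated ψ)
  logDerivative-factored {c} {ψ} C = record
    { unital    = factored-unital c (IsLogDerivative₁.unital ∘ C)
    ; vanishing = separated-vanishing ψ (IsLogDerivative₁.vanishing ∘ C)
    ; equation  = factored-equation c ψ (IsLogDerivative₁.equation ∘ C)
    }

  -- The one-variable series c(p_{m+1}).
  inVar : ℕ → (ℕ → A) → Mono → A
  inVar m       c []      = c 0
  inVar zero    c (a ∷ r) = c a * one r
  inVar (suc m) c (a ∷ r) = δ a * inVar m c r

  inVar-cong : ∀ m {c d} → (∀ a → c a ≡ d a) → inVar m c ≈ inVar m d
  inVar-cong m       eq []      = eq 0
  inVar-cong zero    eq (a ∷ r) = cong (_* one r) (eq a)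
  inVar-cong (suc m) eq (a ∷ r) = cong (δ a *_) (inVar-cong m eq r)

  inVar-⊛ : ∀ m c d → inVar m c ⊛ inVar m d ≈ inVar m (c ⋆ d)
  inVar-⊛ m       c d []      = refl
  inVar-⊛ zero    c d (a ∷ r) =
    trans (⊛-∷ (inVar zero c) (inVar zero d) (λ _ _ → refl) (λ _ _ → refl) a r) (cong ((c ⋆ d) a *_) (⊛-identityˡ one r))
  inVar-⊛ (suc m) c d (a ∷ r) =
    trans (⊛-∷ (inVar (suc m) c) (inVar (suc m) d) (λ _ _ → refl) (λ _ _ → refl) a r) (cong₂ _*_ (Σℕ-δ a δ) (inVar-⊛ m c d r))

  inVar-⊕ : ∀ m c d → inVar m c ⊕ inVar m d ≈ inVar m (λ a → c a + d a)
  inVar-⊕ m       c d []      = refl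
  inVar-⊕ zero    c d (a ∷ r) = sym (distribʳ _ _ _)
  inVar-⊕ (suc m) c d (a ∷ r) = trans (sym (distribˡ _ _ _)) (cong (δ a *_) (inVar-⊕ m c d r))

  inVar-δ : ∀ m → inVar m δ ≈ one
  inVar-δ m       []      = refl
  inVar-δ zero    (a ∷ r) = sym (one-∷ a r)
  inVar-δ (suc m) (a ∷ r) = trans (cong (δ a *_) (inVar-δ m r)) (sym (one-∷ a r))

  inVar-*ˡ : ∀ m k c r → k * inVar m c r ≡ inVar m (λ a → k * c a) r
  inVar-*ˡ m       k c []      = refl
  inVar-*ˡ zero    k c (a ∷ r) = sym (*-assoc _ _ _)
  inVar-*ˡ (suc m) k c (a ∷ r) = trans (leftComm k (δ a) _) (cong (δ a *_) (inVar-*ˡ m k c r))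
    where
    leftComm = solve 3 (λ x y z → x :* (y :* z) := y :* (x :* z)) refl

  -- Coefficient sequences of period two

  -- The coefficients of (x + y t)/(1 - t²); `delayed` has an extra factor t. The fractions t/(1-t),
  -- t/(1+t), t²/(1-t²) and Mehler's exponent all have the latter form.
  alternating : A → A → ℕ → A
  alternating x y zero    = x
  alternating x y (suc k) = alternating y x k

  delayed : A → A → ℕ → A
  delayed x y zero    = 0#
  delayed x y (suc k) = alternating x y k

  alternating-+ : ∀ x y x′ y′ k →
    alternating x y k + alternating x′ y′ k ≡ alternating (x + x′) (y + y′) k
  alternating-+ x y x′ y′ zero    = refl
  alternating-+ x y x′ y′ (suc k) = alternating-+ y x y′ x′ k

  alternating-* : ∀ c x y k → c * alternating x y k ≡ alternating (c * x) (c * y) k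
  alternating-* c x y zero    = refl
  alternating-* c x y (suc k) = alternating-* c y x k

  delayed-* : ∀ c x y k → c * delayed x y k ≡ delayed (c * x) (c * y) k
  delayed-* c x y zero    = zeroʳ c
  delayed-* c x y (suc k) = alternating-* c x y k

  ⋆-congˡ : ∀ {c d} e → (∀ a → c a ≡ d a) → ∀ a → (c ⋆ e) a ≡ (d ⋆ e) a
  ⋆-congˡ e eq a = Σℕ-ext a (λ i j → cong (_* e j) (eq i))

  ⋆-distribʳ : ∀ c d e a → ((λ k → c k + d k) ⋆ e) a ≡ (c ⋆ e) a + (d ⋆ e) a
  ⋆-distribʳ c d e a = trans (Σℕ-ext a (λ _ _ → distribʳ _ _ _)) (Σℕ-+ a)

  ⋆-*ˡ : ∀ k c e a → ((λ i → k * c i) ⋆ e) a ≡ k * (c ⋆ e) a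
  ⋆-*ˡ k c e a = trans (Σℕ-ext a (λ _ _ → *-assoc _ _ _)) (Σℕ-*ˡ a)

  fromℕ-1 : fromℕ 1 ≡ 1#
  fromℕ-1 = trans (fromℕ-suc 0) (trans (cong (1# +_) fromℕ-zero) (+-identityʳ 1#))

  equation-zero : ∀ (c ψ : ℕ → A) → ψ 0 ≡ 0# → θ c 0 ≡ (ψ ⋆ c) 0
  equation-zero c ψ ψ0 = trans (cong (_* c 0) fromℕ-zero)
    (trans (zeroˡ _) (sym (trans (cong (_* c 0) ψ0) (zeroˡ _))))

  -- The coefficients of x²/(1-x²), the logarithmic derivative for x d/dx of (1-x²)^{-1/2}.
  χ₀ : ℕ → A
  χ₀ = delayed 0# 1#

  χ₀-step : ∀ k → χ₀ (2 ℕ.+ k) ≡ χ₀ k + δ k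
  χ₀-step zero    = sym (+-identityˡ 1#)
  χ₀-step (suc k) = sym (+-identityʳ _)

  -- The recursion is (1 - x²) θγ = x² γ read off at x^(a+2), while `χ₀-step` says (1 - x²) χ₀ = x²;
  -- hence an induction in steps of two.
  invSqrt-logDerivative : ∀ γ → γ 0 ≡ 1# → γ 1 ≡ 0# →
    (∀ a → fromℕ (2 ℕ.+ a) * γ (2 ℕ.+ a) ≡ fromℕ (1 ℕ.+ a) * γ a) → IsLogDerivative₁ γ χ₀
  invSqrt-logDerivative γ γ0 γ1 γ-step = record { unital = γ0 ; equation = equation }
    where
    equation : ∀ a → θ γ a ≡ (χ₀ ⋆ γ) a
    equation zero          = equation-zero γ χ₀ refl
    equation (suc zero)    = begin
      fromℕ 1 * γ 1              ≡⟨ cong (fromℕ 1 *_) γ1 ⟩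
      fromℕ 1 * 0#               ≡⟨ zeroʳ _ ⟩
      0#                         ≡⟨ +-identityˡ 0# ⟨
      0# + 0#                    ≡⟨ cong₂ _+_ (zeroˡ _) (zeroˡ _) ⟨
      0# * γ 1 + 0# * γ 0        ∎
    equation (suc (suc a)) = begin
      fromℕ (2 ℕ.+ a) * γ (2 ℕ.+ a)
        ≡⟨ γ-step a ⟩
      fromℕ (1 ℕ.+ a) * γ a
        ≡⟨ cong (_* γ a) (fromℕ-suc a) ⟩
      (1# + fromℕ a) * γ a
        ≡⟨ distribʳ _ _ _ ⟩
      1# * γ a + fromℕ a * γ a
        ≡⟨ cong₂ _+_ (*-identityˡ _) (equation a) ⟩
      γ a + (χ₀ ⋆ γ) a
        ≡⟨ +-comm _ _ ⟩
      (χ₀ ⋆ γ) a + γ a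
        ≡⟨ +-congˡ (Σℕ-δ a γ) ⟨
      (χ₀ ⋆ γ) a + (δ ⋆ γ) a
        ≡⟨ ⋆-distribʳ χ₀ δ γ a ⟨
      ((λ k → χ₀ k + δ k) ⋆ γ) a
        ≡⟨ ⋆-congˡ γ χ₀-step a ⟨
      ((λ k → χ₀ (2 ℕ.+ k)) ⋆ γ) a
        ≡⟨ drop₂ (γ (2 ℕ.+ a)) (γ (1 ℕ.+ a)) _ ⟩
      (χ₀ ⋆ γ) (2 ℕ.+ a) ∎
      where
      drop₂ : ∀ x y z → z ≡ 0# * x + (0# * y + z)
      drop₂ = solve 3 (λ x y z → z := con 0 :* x :+ (con 0 :* y :+ z)) refl

  -- Exponentials and geometric series as truncated sums

  Σ≤ : ℕ → (ℕ → A) → A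
  Σ≤ zero    f = f 0
  Σ≤ (suc n) f = Σ≤ n f + f (suc n)

  Σ≤-cong : ∀ n {f g} → (∀ k → f k ≡ g k) → Σ≤ n f ≡ Σ≤ n g
  Σ≤-cong zero    eq = eq 0
  Σ≤-cong (suc n) eq = cong₂ _+_ (Σ≤-cong n eq) (eq (suc n))

  Σ≤-first : ∀ n f → Σ≤ (suc n) f ≡ f 0 + Σ≤ n (f ∘ suc)
  Σ≤-first zero    f = refl
  Σ≤-first (suc n) f = trans (+-congʳ (Σ≤-first n f)) (+-assoc _ _ _)

  Σ≤-*ˡ : ∀ n {x f} → Σ≤ n (λ k → x * f k) ≡ x * Σ≤ n f
  Σ≤-*ˡ zero    = refl
  Σ≤-*ˡ (suc n) = trans (+-congʳ (Σ≤-*ˡ n)) (sym (distribˡ _ _ _))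

  Σ≤-zero : ∀ n → Σ≤ n (λ _ → 0#) ≡ 0#
  Σ≤-zero zero    = refl
  Σ≤-zero (suc n) = trans (+-identityʳ _) (Σ≤-zero n)

  Σ≤-stable : ∀ {m f} n → m ≤ n → (∀ k → m < k → f k ≡ 0#) → Σ≤ n f ≡ Σ≤ m f
  Σ≤-stable {m} zero z≤n tail = refl
  Σ≤-stable {m} {f} (suc n) m≤1+n tail with ℕ.m≤n⇒m<n∨m≡n m≤1+n
  ... | inj₂ refl    = refl
  ... | inj₁ m<1+n   = begin
    Σ≤ n f + f (suc n)  ≡⟨ cong₂ _+_ (Σ≤-stable n (ℕ.s≤s⁻¹ m<1+n) tail) (tail (suc n) m<1+n) ⟩
    Σ≤ m f + 0#         ≡⟨ +-identityʳ _ ⟩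
    Σ≤ m f              ∎

  pow : (Mono → A) → ℕ → Mono → A
  pow f zero    = one
  pow f (suc k) = f ⊛ pow f k

  -- Every factor `f` contributes degree at least 1. This is why the truncations are exact.
  pow-order : ∀ f → Vanishing f → ∀ k r → deg r < k → pow f k r ≡ 0#
  pow-order f f0 (suc k) r (s≤s r≤k) = trans (Σᴹ-cong r term) (Σᴹ-zero r)
    where
    term : ∀ s t → deg s ℕ.+ deg t ≡ deg r → f s * pow f k t ≡ 0#
    term s t e with deg s in es
    ... | zero  = trans (cong (_* pow f k t) (f0 s es)) (zeroˡ _)
    ... | suc d = trans (cong (f s *_) (pow-order f f0 k t
                    (ℕ.<-≤-trans (s≤s (ℕ.m≤n+m (deg t) d)) (ℕ.≤-trans (ℕ.≤-reflexive e) r≤k)))) (zeroʳ _)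

  D-pow : ∀ f k r → D (pow f (suc k)) r ≡ fromℕ (suc k) * (D f ⊛ pow f k) r
  D-pow f k r = begin
    D (f ⊛ pow f k) r                                          ≡⟨ D-⊛ f (pow f k) r ⟩
    (D f ⊛ pow f k) r + (f ⊛ D (pow f k)) r                    ≡⟨ +-congˡ (rest k) ⟩
    (D f ⊛ pow f k) r + fromℕ k * (D f ⊛ pow f k) r            ≡⟨ +-congʳ (*-identityˡ _) ⟨
    1# * (D f ⊛ pow f k) r + fromℕ k * (D f ⊛ pow f k) r       ≡⟨ distribʳ _ _ _ ⟨
    (1# + fromℕ k) * (D f ⊛ pow f k) r                         ≡⟨ cong (_* (D f ⊛ pow f k) r) (fromℕ-suc k) ⟨
    fromℕ (suc k) * (D f ⊛ pow f k) r                          ∎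
    where
    leftComm = solve 3 (λ x y z → x :* (y :* z) := y :* (x :* z)) refl
    rest : ∀ k → (f ⊛ D (pow f k)) r ≡ fromℕ k * (D f ⊛ pow f k) r
    rest zero    = begin
      Σᴹ (λ s t → f s * D one t) r   ≡⟨ Σᴹ-ext r (λ s t → trans (cong (f s *_) (deg-one t)) (zeroʳ _)) ⟩
      Σᴹ (λ s t → 0#) r              ≡⟨ Σᴹ-zero r ⟩
      0#                             ≡⟨ zeroˡ _ ⟨
      0# * (D f ⊛ one) r             ≡⟨ cong (_* (D f ⊛ one) r) fromℕ-zero ⟨
      fromℕ 0 * (D f ⊛ one) r        ∎
    rest (suc k) = begin
      Σᴹ (λ s t → f s * D (pow f (suc k)) t) r
        ≡⟨ Σᴹ-ext r (λ s t → trans (cong (f s *_) (D-pow f k t)) (leftComm _ _ _)) ⟩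
      Σᴹ (λ s t → fromℕ (suc k) * (f s * (D f ⊛ pow f k) t)) r
        ≡⟨ Σᴹ-*ˡ r ⟩
      fromℕ (suc k) * (f ⊛ (D f ⊛ pow f k)) r
        ≡⟨ cong (fromℕ (suc k) *_) (⊛-leftComm f (D f) (pow f k) r) ⟩
      fromℕ (suc k) * (D f ⊛ pow f (suc k)) r ∎

  -- Σ_k e_k f^k, cut off at the degree of the monomial.
  compose : (ℕ → A) → (Mono → A) → Mono → A
  compose e f r = Σ≤ (deg r) (λ k → e k * pow f k r)

  -- Needed for three cutoffs: `wdeg r` in the definitions, one more term when a sum is shifted, and
  -- the degree of the whole monomial inside a product.
  compose-stable : ∀ e f → Vanishing f → ∀ n r → deg r ≤ n → Σ≤ n (λ k → e k * pow f k r) ≡ compose e f r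
  compose-stable e f f0 n r r≤n =
    Σ≤-stable n r≤n (λ k r<k → trans (cong (e k *_) (pow-order f f0 k r r<k)) (zeroʳ _))

  ⊛-compose : ∀ e f g → Vanishing f → ∀ r →
    Σ≤ (deg r) (λ k → e k * (g ⊛ pow f k) r) ≡ (g ⊛ compose e f) r
  ⊛-compose e f g f0 r = trans (swap (deg r)) (Σᴹ-cong r (λ s t e′ →
    cong (g s *_) (compose-stable e f f0 (deg r) t (ℕ.m+n≤o⇒n≤o (deg s) (ℕ.≤-reflexive e′)))))
    where
    leftComm = solve 3 (λ x y z → x :* (y :* z) := y :* (x :* z)) refl
    scaled : ∀ k → e k * (g ⊛ pow f k) r ≡ Σᴹ (λ s t → g s * (e k * pow f k t)) r
    scaled k = trans (sym (Σᴹ-*ˡ r)) (Σᴹ-ext r (λ _ _ → leftComm _ _ _))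
    swap : ∀ n → Σ≤ n (λ k → e k * (g ⊛ pow f k) r) ≡ (g ⊛ (λ t → Σ≤ n (λ k → e k * pow f k t))) r
    swap zero    = scaled 0
    swap (suc n) = trans (cong₂ _+_ (swap n) (scaled (suc n)))
      (trans (sym (Σᴹ-+ r)) (Σᴹ-ext r (λ _ _ → sym (distribˡ _ _ _))))

  exp-logDerivative : ∀ e f → Vanishing f → e 0 ≡ 1# → (∀ k → fromℕ (suc k) * e (suc k) ≡ e k) →
    IsLogDerivative (compose e f) (D f)
  exp-logDerivative e f f0 e0 e-suc = record
    { unital    = unital
    ; vanishing = D-vanishing f
    ; equation  = equation
    }
    where
    unital : Unital (compose e f)
    unital r r0 = begin
      Σ≤ (deg r) (λ k → e k * pow f k r)  ≡⟨ cong (λ d → Σ≤ d (λ k → e k * pow f k r)) r0 ⟩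
      e 0 * one r                         ≡⟨ cong₂ _*_ e0 (one-deg0 r r0) ⟩
      1# * 1#                             ≡⟨ *-identityˡ 1# ⟩
      1#                                  ∎
    leftComm = solve 3 (λ x y z → x :* (y :* z) := y :* (x :* z)) refl
    regroup = solve 3 (λ x y z → x :* (y :* z) := (y :* x) :* z) refl
    term : ∀ r k → fromℕ (deg r) * (e (suc k) * pow f (suc k) r) ≡ e k * (D f ⊛ pow f k) r
    term r k = begin
      fromℕ (deg r) * (e (suc k) * pow f (suc k) r)      ≡⟨ leftComm _ _ _ ⟩
      e (suc k) * D (pow f (suc k)) r                    ≡⟨ cong (e (suc k) *_) (D-pow f k r) ⟩
      e (suc k) * (fromℕ (suc k) * (D f ⊛ pow f k) r)    ≡⟨ regroup _ _ _ ⟩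
      fromℕ (suc k) * e (suc k) * (D f ⊛ pow f k) r      ≡⟨ cong (_* (D f ⊛ pow f k) r) (e-suc k) ⟩
      e k * (D f ⊛ pow f k) r                            ∎
    equation : D (compose e f) ≈ D f ⊛ compose e f
    equation r = begin
      fromℕ d * compose e f r
        -- One more, vanishing, term is added: D lowers the exponent k + 1 to k, and after the shift
        -- the sum again ends at `d`.
        ≡⟨ cong (fromℕ d *_) (compose-stable e f f0 (suc d) r (ℕ.n≤1+n d)) ⟨
      fromℕ d * Σ≤ (suc d) (λ k → e k * pow f k r)
        ≡⟨ Σ≤-*ˡ (suc d) ⟨
      Σ≤ (suc d) (λ k → fromℕ d * (e k * pow f k r))
        ≡⟨ Σ≤-first d _ ⟩
      fromℕ d * (e 0 * one r) + Σ≤ d (λ k → fromℕ d * (e (suc k) * pow f (suc k) r))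
        ≡⟨ cong₂ _+_ (trans (leftComm _ _ _) (trans (cong (e 0 *_) (deg-one r)) (zeroʳ _))) (Σ≤-cong d (term r)) ⟩
      0# + Σ≤ d (λ k → e k * (D f ⊛ pow f k) r)
        ≡⟨ +-identityˡ _ ⟩
      Σ≤ d (λ k → e k * (D f ⊛ pow f k) r)
        ≡⟨ ⊛-compose e f (D f) f0 r ⟩
      (D f ⊛ compose e f) r ∎
      where d = deg r

  geometric : (Mono → A) → Mono → A
  geometric = compose (λ _ → 1#)

  -- Splitting off the term k = 0 leaves `f` times the same series; this is 1/(1-f) = 1 + f/(1-f).
  geometric-fixpoint : ∀ f → Vanishing f → geometric f ≈ one ⊕ (f ⊛ geometric f)
  geometric-fixpoint f f0 r = begin
    geometric f r
      ≡⟨ compose-stable (λ _ → 1#) f f0 (suc (deg r)) r (ℕ.n≤1+n (deg r)) ⟨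
    Σ≤ (suc (deg r)) (λ k → 1# * pow f k r)
      ≡⟨ Σ≤-first (deg r) _ ⟩
    1# * one r + Σ≤ (deg r) (λ k → 1# * (f ⊛ pow f k) r)
      ≡⟨ cong₂ _+_ (*-identityˡ _) (⊛-compose (λ _ → 1#) f f f0 r) ⟩
    one r + (f ⊛ geometric f) r ∎

  -- Infinite sums and products over the variables

  Σ< : ℕ → (ℕ → A) → A
  Σ< zero    f = 0#
  Σ< (suc n) f = f 0 + Σ< n (f ∘ suc)

  Σ<-cong : ∀ n {f g} → (∀ k → f k ≡ g k) → Σ< n f ≡ Σ< n g
  Σ<-cong zero    eq = refl
  Σ<-cong (suc n) eq = cong₂ _+_ (eq 0) (Σ<-cong n (eq ∘ suc))

  Σ<-*ˡ : ∀ n {x f} → Σ< n (λ k → x * f k) ≡ x * Σ< n f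
  Σ<-*ˡ zero    = sym (zeroʳ _)
  Σ<-*ˡ (suc n) = trans (+-congˡ (Σ<-*ˡ n)) (sym (distribˡ _ _ _))

  Σ<-+ : ∀ n {f g} → Σ< n (λ k → f k + g k) ≡ Σ< n f + Σ< n g
  Σ<-+ zero    = sym (+-identityˡ 0#)
  Σ<-+ (suc n) = trans (+-congˡ (Σ<-+ n)) (+-interchange _ _ _ _)

  Σ<-zero : ∀ n {f} → (∀ k → f k ≡ 0#) → Σ< n f ≡ 0#
  Σ<-zero zero    eq = refl
  Σ<-zero (suc n) eq = trans (cong₂ _+_ (eq 0) (Σ<-zero n (eq ∘ suc))) (+-identityˡ 0#)

  wdeg′-tail : ∀ i n a r → wdeg′ (suc i) (a ∷ r) < suc i ℕ.+ suc n → wdeg′ (2 ℕ.+ i) r < (2 ℕ.+ i) ℕ.+ n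
  wdeg′-tail i n a r lt = ℕ.≤-<-trans (ℕ.m≤n+m _ (suc i ℕ.* a))
    (ℕ.<-≤-trans lt (ℕ.≤-reflexive (ℕ.+-suc (suc i) n)))

  wdeg′<i⇒deg≡0 : ∀ i r → wdeg′ (suc i) r < suc i → deg r ≡ 0
  wdeg′<i⇒deg≡0 i []          lt = refl
  wdeg′<i⇒deg≡0 i (zero ∷ r)  lt = wdeg′<i⇒deg≡0 (suc i) r
    (ℕ.<-trans (ℕ.≤-<-trans (ℕ.m≤n+m _ (suc i ℕ.* 0)) lt) (ℕ.n<1+n (suc i)))
  wdeg′<i⇒deg≡0 i (suc a ∷ r) lt = contradiction lt (ℕ.≤⇒≯
    (ℕ.≤-trans (ℕ.m≤m*n (suc i) (suc a)) (ℕ.m≤m+n _ (wdeg′ (2 ℕ.+ i) r))))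

  -- The list `r` is read as starting at the variable of weight i + 1. A monomial of weight below i
  -- + 1 + n contains none of the variables after the first n, so the cutoff loses nothing. The
  -- start `i` is general because passing to the tail raises it while lowering `n`.
  Σ<-inVar : ∀ n i φ → (∀ m → φ m 0 ≡ 0#) → ∀ r → wdeg′ (suc i) r < suc i ℕ.+ n →
    Σ< n (λ m → inVar m (φ m) r) ≡ separated φ r
  Σ<-inVar zero    i φ φ0 r       lt = sym (separated-vanishing φ φ0 r
    (wdeg′<i⇒deg≡0 i r (ℕ.<-≤-trans lt (ℕ.≤-reflexive (ℕ.+-identityʳ (suc i))))))
  Σ<-inVar (suc n) i φ φ0 []      lt = Σ<-zero (suc n) φ0
  Σ<-inVar (suc n) i φ φ0 (a ∷ r) lt = +-congˡ (trans (Σ<-*ˡ n)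
    (cong (δ a *_) (Σ<-inVar n (suc i) (φ ∘ suc) (φ0 ∘ suc) r (wdeg′-tail i n a r lt))))

  Π≤ : ℕ → (ℕ → Mono → A) → Mono → A
  Π≤ zero    F = one
  Π≤ (suc n) F = Π≤ n F ⊛ F n

  Π≤-inVar-∷ : ∀ n (c : ℕ → ℕ → A) a r →
    Π≤ (suc n) (λ m → inVar m (c m)) (a ∷ r) ≡ c 0 a * Π≤ n (λ m → inVar m (c (suc m))) r
  Π≤-inVar-∷ zero    c a r = begin
    (one ⊛ inVar 0 (c 0)) (a ∷ r)   ≡⟨ ⊛-identityˡ (inVar 0 (c 0)) (a ∷ r) ⟩
    c 0 a * one r                   ∎
  Π≤-inVar-∷ (suc n) c a r = begin
    (Π≤ (suc n) (λ m → inVar m (c m)) ⊛ inVar (suc n) (c (suc n))) (a ∷ r)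
      ≡⟨ ⊛-∷ (Π≤ (suc n) (λ m → inVar m (c m))) (inVar (suc n) (c (suc n))) (Π≤-inVar-∷ n c) (λ _ _ → refl) a r ⟩
    (c 0 ⋆ δ) a * Π≤ (suc n) (λ m → inVar m (c (suc m))) r
      ≡⟨ cong (_* Π≤ (suc n) (λ m → inVar m (c (suc m))) r) (trans (⋆-comm (c 0) δ a) (Σℕ-δ a (c 0))) ⟩
    c 0 a * Π≤ (suc n) (λ m → inVar m (c (suc m))) r ∎

  Π≤-inVar : ∀ n i (c : ℕ → ℕ → A) → (∀ m → c m 0 ≡ 1#) → ∀ r → wdeg′ (suc i) r < suc i ℕ.+ n →
    Π≤ n (λ m → inVar m (c m)) r ≡ factored c r
  Π≤-inVar zero    i c c0 r       lt = trans (one-deg0 r r0) (sym (factored-unital c c0 r r0))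
    where r0 = wdeg′<i⇒deg≡0 i r (ℕ.<-≤-trans lt (ℕ.≤-reflexive (ℕ.+-identityʳ (suc i))))
  Π≤-inVar (suc n) i c c0 []      lt =
    trans (cong₂ _*_ (Π≤-inVar n i c c0 [] (s≤s z≤n)) (c0 n)) (*-identityˡ 1#)
  Π≤-inVar (suc n) i c c0 (a ∷ r) lt = trans (Π≤-inVar-∷ n c a r)
    (cong (c 0 a *_) (Π≤-inVar n (suc i) (c ∘ suc) (c0 ∘ suc) r (wdeg′-tail i n a r lt)))

  separated-*ˡ : ∀ x φ r → x * separated φ r ≡ separated (λ m a → x * φ m a) r
  separated-*ˡ x φ []      = zeroʳ x
  separated-*ˡ x φ (a ∷ r) = trans
    (solve 5 (λ x y o d s → x :* (y :* o :+ d :* s) := x :* y :* o :+ d :* (x :* s)) refl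
      x (φ 0 a) (one r) (δ a) (separated (φ ∘ suc) r))
    (cong (λ s → x * φ 0 a * one r + δ a * s) (separated-*ˡ x (φ ∘ suc) r))

  -- Exponents above `deg r` do not occur in `r`, so a cut-off sum that is correct only in low
  -- degree may replace the full series.
  inVar-cong-≤ : ∀ m {c d} r → (∀ a → a ≤ deg r → c a ≡ d a) → inVar m c r ≡ inVar m d r
  inVar-cong-≤ m       []      eq = eq 0 z≤n
  inVar-cong-≤ zero    (a ∷ r) eq = cong (_* one r) (eq a (ℕ.m≤m+n a (deg r)))
  inVar-cong-≤ (suc m) (a ∷ r) eq =
    cong (δ a *_) (inVar-cong-≤ m r (λ b b≤ → eq b (ℕ.≤-trans b≤ (ℕ.m≤n+m (deg r) a))))

  Σ≤-inVar : ∀ n m (c : ℕ → ℕ → A) r →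
    Σ≤ n (λ k → inVar m (c k) r) ≡ inVar m (λ a → Σ≤ n (λ k → c k a)) r
  Σ≤-inVar zero    m c r = refl
  Σ≤-inVar (suc n) m c r = trans (+-congʳ (Σ≤-inVar n m c r)) (inVar-⊕ m _ _ r)

  inVar-vanishing : ∀ m c → c 0 ≡ 0# → Vanishing (inVar m c)
  inVar-vanishing m       c c0 []         _ = c0
  inVar-vanishing zero    c c0 (zero ∷ r) _ = trans (cong (_* one r) c0) (zeroˡ _)
  inVar-vanishing (suc m) c c0 (zero ∷ r) e = trans (*-identityˡ _) (inVar-vanishing m c c0 r e)

  -- Powers of a single variable

  monomial : ℕ → ℕ → A
  monomial zero    a       = δ a
  monomial (suc k) zero    = 0#
  monomial (suc k) (suc a) = monomial k a

  monomial-suc-⋆-zero : ∀ k c → (monomial (suc k) ⋆ c) 0 ≡ 0#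
  monomial-suc-⋆-zero k c = zeroˡ _

  monomial-suc-⋆-suc : ∀ k c a → (monomial (suc k) ⋆ c) (suc a) ≡ (monomial k ⋆ c) a
  monomial-suc-⋆-suc k c a = trans (+-congʳ (zeroˡ _)) (+-identityˡ _)

  monomial-1-⋆-suc : ∀ c a → (monomial 1 ⋆ c) (suc a) ≡ c a
  monomial-1-⋆-suc c a = trans (monomial-suc-⋆-suc 0 c a) (Σℕ-δ a c)

  monomial-⋆ : ∀ k a → (monomial 1 ⋆ monomial k) a ≡ monomial (suc k) a
  monomial-⋆ k zero    = monomial-suc-⋆-zero 0 (monomial k)
  monomial-⋆ k (suc a) = monomial-1-⋆-suc (monomial k) a

  pow-inVar : ∀ m k {f} → f ≈ inVar m (monomial 1) → pow f k ≈ inVar m (monomial k)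
  pow-inVar m zero    eq r = sym (inVar-δ m r)
  pow-inVar m (suc k) eq r = trans (⊛-cong eq (pow-inVar m k eq) r)
    (trans (inVar-⊛ m (monomial 1) (monomial k) r) (inVar-cong m (monomial-⋆ k) r))

  power : A → ℕ → A
  power s zero    = 1#
  power s (suc a) = s * power s a

  power-* : ∀ s t a → power s a * power t a ≡ power (s * t) a
  power-* s t zero    = *-identityˡ 1#
  power-* s t (suc a) = trans (*-interchange _ _ _ _) (cong (s * t *_) (power-* s t a))

  double : ℕ → ℕ
  double zero    = zero
  double (suc k) = suc (suc (double k))

  -- An even series is the sum of its even terms. The induction divides by x², which lowers the
  -- exponent by two and the cutoff by one.
  Σ≤-even-monomials : ∀ n a (c : ℕ → A) → a ≤ n → (∀ k → c (suc (double k)) ≡ 0#) →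
    Σ≤ n (λ k → c (double k) * monomial (double k) a) ≡ c a
  Σ≤-even-monomials zero    zero          c _ odd = *-identityʳ _
  Σ≤-even-monomials (suc n) zero          c _ odd = begin
    Σ≤ (suc n) (λ k → c (double k) * monomial (double k) 0)  ≡⟨ Σ≤-first n _ ⟩
    c 0 * 1# + Σ≤ n (λ k → c (2 ℕ.+ double k) * 0#)          ≡⟨ cong₂ _+_ (*-identityʳ _) (trans (Σ≤-cong n (λ _ → zeroʳ _)) (Σ≤-zero n)) ⟩
    c 0 + 0#                                                 ≡⟨ +-identityʳ _ ⟩
    c 0                                                      ∎
  Σ≤-even-monomials (suc n) (suc zero)    c _ odd = begin
    Σ≤ (suc n) (λ k → c (double k) * monomial (double k) 1)  ≡⟨ Σ≤-first n _ ⟩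
    c 0 * 0# + Σ≤ n (λ k → c (2 ℕ.+ double k) * 0#)          ≡⟨ cong₂ _+_ (zeroʳ _) (trans (Σ≤-cong n (λ _ → zeroʳ _)) (Σ≤-zero n)) ⟩
    0# + 0#                                                  ≡⟨ +-identityˡ 0# ⟩
    0#                                                       ≡⟨ odd 0 ⟨
    c 1                                                      ∎
  Σ≤-even-monomials (suc n) (suc (suc a)) c a≤n odd = begin
    Σ≤ (suc n) (λ k → c (double k) * monomial (double k) (2 ℕ.+ a))
      ≡⟨ Σ≤-first n _ ⟩
    c 0 * 0# + Σ≤ n (λ k → c (2 ℕ.+ double k) * monomial (double k) a)
      ≡⟨ cong₂ _+_ (zeroʳ _) (Σ≤-even-monomials n a (λ k → c (2 ℕ.+ k)) (ℕ.≤-trans (ℕ.n≤1+n a) (ℕ.s≤s⁻¹ a≤n)) (odd ∘ suc)) ⟩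
    0# + c (2 ℕ.+ a)
      ≡⟨ +-identityˡ _ ⟩
    c (2 ℕ.+ a) ∎

  -- One-variable exponentials and Hermite numbers

  -- One variable p_n: n stands for the image of that number in A, ν for 1/n, and w r for 1/(n^r r!).
  module Hermite (n ν : A) (n*ν : n * ν ≡ 1#) (w : ℕ → A) (w-zero : w 0 ≡ 1#)
    (w-suc : ∀ a → n * (fromℕ (suc a) * w (suc a)) ≡ w a) where

    w-step : ∀ a → fromℕ (suc a) * w (suc a) ≡ ν * w a
    w-step a = begin
      x                ≡⟨ *-identityˡ x ⟨
      1# * x           ≡⟨ cong (_* x) n*ν ⟨
      n * ν * x        ≡⟨ rotate n ν x ⟩
      ν * (n * x)      ≡⟨ cong (ν *_) (w-suc a) ⟩
      ν * w a          ∎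
      where
      x = fromℕ (suc a) * w (suc a)
      rotate = solve 3 (λ n ν x → n :* ν :* x := ν :* (n :* x)) refl

    -- n^r r! times the coefficients of exp(x²/2n + a x/n).
    hermite : A → ℕ → A
    hermite a zero          = 1#
    hermite a (suc zero)    = a
    hermite a (suc (suc r)) = a * hermite a (suc r) + n * (fromℕ (suc r) * hermite a r)

    gauss : A → ℕ → A
    gauss a r = hermite a r * w r

    -- This is θ of s x/n, and `quadratic` is θ of x²/2n + a x/n, where the derivative of x² removes
    -- the 2 from the denominator.
    linear : A → ℕ → A
    linear s (suc zero) = s * ν
    linear s _          = 0#

    quadratic : A → ℕ → A
    quadratic a (suc zero)       = a * ν
    quadratic a (suc (suc zero)) = ν
    quadratic a _                = 0#

    quadratic-linear : ∀ a s k → quadratic a k + linear s k ≡ quadratic (a + s) k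
    quadratic-linear a s zero                = +-identityʳ 0#
    quadratic-linear a s (suc zero)          = sym (distribʳ _ _ _)
    quadratic-linear a s (suc (suc zero))    = +-identityʳ _
    quadratic-linear a s (suc (suc (suc k))) = +-identityʳ 0#

    linear-logDerivative : ∀ s → IsLogDerivative₁ (λ r → power s r * w r) (linear s)
    linear-logDerivative s = record { unital = trans (*-identityˡ _) w-zero ; equation = equation }
      where
      c : ℕ → A
      c r = power s r * w r

      tail : ∀ k → linear s (suc k) ≡ s * ν * δ k
      tail zero    = sym (*-identityʳ _)
      tail (suc k) = sym (zeroʳ _)

      swap = solve 4 (λ m s q x → m :* (s :* q :* x) := s :* q :* (m :* x)) refl
      move = solve 4 (λ s q ν x → s :* q :* (ν :* x) := s :* ν :* (q :* x)) refl

      equation : ∀ r → θ c r ≡ (linear s ⋆ c) r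
      equation zero    = equation-zero c (linear s) refl
      equation (suc r) = begin
        fromℕ (suc r) * (s * power s r * w (suc r)) ≡⟨ swap (fromℕ (suc r)) s (power s r) (w (suc r)) ⟩
        s * power s r * (fromℕ (suc r) * w (suc r)) ≡⟨ cong (s * power s r *_) (w-step r) ⟩
        s * power s r * (ν * w r)                   ≡⟨ move s (power s r) ν (w r) ⟩
        s * ν * c r                                 ≡⟨ cong (s * ν *_) (Σℕ-δ r c) ⟨
        s * ν * (δ ⋆ c) r                           ≡⟨ ⋆-*ˡ (s * ν) δ c r ⟨
        ((λ k → s * ν * δ k) ⋆ c) r                 ≡⟨ ⋆-congˡ c tail r ⟨
        ((linear s ∘ suc) ⋆ c) r                    ≡⟨ +-identityˡ _ ⟨
        0# + ((linear s ∘ suc) ⋆ c) r               ≡⟨ +-congʳ (zeroˡ _) ⟨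
        (linear s ⋆ c) (suc r)                      ∎

    -- At x^(r+2) the equation reads (r+2) g(r+2) = (a g(r+1) + g(r))/n, which is the recursion of
    -- `hermite` with the weights `w` put back.
    gauss-logDerivative : ∀ a → IsLogDerivative₁ (gauss a) (quadratic a)
    gauss-logDerivative a = record { unital = trans (*-identityˡ _) w-zero ; equation = equation }
      where
      tail : ∀ k → quadratic a (2 ℕ.+ k) ≡ ν * δ k
      tail zero    = sym (*-identityʳ _)
      tail (suc k) = sym (zeroʳ _)

      lemma₁ = solve 3 (λ a ν x → a :* (ν :* x) := a :* ν :* (con 1 :* x)) refl
      swap = solve 3 (λ m x y → m :* (x :* y) := x :* (m :* y)) refl
      expand = solve 7 (λ a n m ν x y w → (a :* x :+ n :* (m :* y)) :* (ν :* w) :=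
                 a :* ν :* (x :* w) :+ ν :* (y :* (n :* (m :* w)))) refl

      equation : ∀ r → θ (gauss a) r ≡ (quadratic a ⋆ gauss a) r
      equation zero          = equation-zero (gauss a) (quadratic a) refl
      equation (suc zero)    = begin
        fromℕ 1 * (a * w 1)           ≡⟨ swap (fromℕ 1) a (w 1) ⟩
        a * (fromℕ 1 * w 1)           ≡⟨ cong (a *_) (w-step 0) ⟩
        a * (ν * w 0)                 ≡⟨ lemma₁ a ν (w 0) ⟩
        a * ν * (1# * w 0)            ≡⟨ +-identityˡ _ ⟨
        0# + a * ν * gauss a 0        ≡⟨ +-congʳ (zeroˡ _) ⟨
        0# * gauss a 1 + a * ν * gauss a 0 ∎
      equation (suc (suc r)) = begin
        fromℕ (2 ℕ.+ r) * (hermite a (2 ℕ.+ r) * w (2 ℕ.+ r))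
          ≡⟨ swap (fromℕ (2 ℕ.+ r)) (hermite a (2 ℕ.+ r)) (w (2 ℕ.+ r)) ⟩
        hermite a (2 ℕ.+ r) * (fromℕ (2 ℕ.+ r) * w (2 ℕ.+ r))
          ≡⟨ cong (hermite a (2 ℕ.+ r) *_) (w-step (suc r)) ⟩
        hermite a (2 ℕ.+ r) * (ν * w (suc r))
          ≡⟨ expand a n (fromℕ (suc r)) ν (hermite a (suc r)) (hermite a r) (w (suc r)) ⟩
        a * ν * gauss a (suc r) + ν * (hermite a r * (n * (fromℕ (suc r) * w (suc r))))
          ≡⟨ cong (λ x → a * ν * gauss a (suc r) + ν * (hermite a r * x)) (w-suc r) ⟩
        a * ν * gauss a (suc r) + ν * gauss a r
          ≡⟨ cong (λ x → a * ν * gauss a (suc r) + ν * x) (Σℕ-δ r (gauss a)) ⟨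
        a * ν * gauss a (suc r) + ν * (δ ⋆ gauss a) r
          ≡⟨ +-congˡ (trans (⋆-congˡ (gauss a) tail r) (⋆-*ˡ ν δ (gauss a) r)) ⟨
        a * ν * gauss a (suc r) + ((λ k → quadratic a (2 ℕ.+ k)) ⋆ gauss a) r
          ≡⟨ +-identityˡ _ ⟨
        0# + (a * ν * gauss a (suc r) + ((λ k → quadratic a (2 ℕ.+ k)) ⋆ gauss a) r)
          ≡⟨ +-congʳ (zeroˡ _) ⟨
        (quadratic a ⋆ gauss a) (2 ℕ.+ r) ∎

    -- Substituting s x for x turns exp(x²/2n + a x/n) into exp(s² x²/2n + s a x/n), and s² = 1.
    hermite-sign : ∀ s → s * s ≡ 1# → ∀ a r → power s r * hermite a r ≡ hermite (s * a) r
    hermite-sign s s² a zero          = *-identityˡ 1#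
    hermite-sign s s² a (suc zero)    = cong (_* a) (*-identityʳ s)
    hermite-sign s s² a (suc (suc r)) = begin
      s * (s * power s r) * (a * hermite a (suc r) + n * (fromℕ (suc r) * hermite a r))
        ≡⟨ expand s (power s r) a n (fromℕ (suc r)) (hermite a (suc r)) (hermite a r) ⟩
      s * a * (power s (suc r) * hermite a (suc r)) + s * s * (n * (fromℕ (suc r) * (power s r * hermite a r)))
        ≡⟨ +-congˡ (trans (cong (_* (n * (fromℕ (suc r) * (power s r * hermite a r)))) s²) (*-identityˡ _)) ⟩
      s * a * (power s (suc r) * hermite a (suc r)) + n * (fromℕ (suc r) * (power s r * hermite a r))
        ≡⟨ cong₂ (λ x y → s * a * x + n * (fromℕ (suc r) * y)) (hermite-sign s s² a (suc r)) (hermite-sign s s² a r) ⟩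
      hermite (s * a) (2 ℕ.+ r) ∎
      where
      expand = solve 7 (λ s q a n m x y → s :* (s :* q) :* (a :* x :+ n :* (m :* y)) :=
                 s :* a :* (s :* q :* x) :+ s :* s :* (n :* (m :* (q :* y)))) refl

    -- The exponent (a b x + (a² + b²) x²/2) / (n (1-x²)) of Mehler's formula, with η for 1/2n.
    mehlerExponent : A → A → A → ℕ → A
    mehlerExponent η a b = delayed (a * b * ν) ((a * a + b * b) * η)

    -- Mehler's formula

    module Mehler (η : A) (η+η : η + η ≡ ν) (a b : A) where

      -- `U` collects the coefficients of the Kronecker product in one variable. Its recursion does
      -- not close on itself; `V` and `W`, with one Hermite index raised, complete the system.
      U V W : ℕ → A
      U r = hermite a r * hermite b r * w r
      V r = hermite a (suc r) * hermite b r * w r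
      W r = hermite a r * hermite b (suc r) * w r

      χ : ℕ → A
      χ k = χ₀ k + θ (mehlerExponent η a b) k

      -- The numerator σ + τ x of (a (a + b x) + b (b + a x))/(n (1-x²)), the factor of `U` in (a V
      -- + b W)/n.
      σ τ : A
      σ = (a * a + b * b) * ν
      τ = a * b * ν + a * b * ν

      V-suc : ∀ r → V (suc r) ≡ a * U (suc r) + W r
      V-suc r = trans
        (expand a n (fromℕ (suc r)) (hermite a (suc r)) (hermite a r) (hermite b (suc r)) (w (suc r)))
        (cong (λ x → a * U (suc r) + hermite a r * hermite b (suc r) * x) (w-suc r))
        where
        expand = solve 7 (λ a n m x y z w → (a :* x :+ n :* (m :* y)) :* z :* w :=
                   a :* (x :* z :* w) :+ y :* z :* (n :* (m :* w))) refl

      W-suc : ∀ r → W (suc r) ≡ b * U (suc r) + V r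
      W-suc r = trans
        (expand b n (fromℕ (suc r)) (hermite b (suc r)) (hermite b r) (hermite a (suc r)) (w (suc r)))
        (cong (λ x → b * U (suc r) + hermite a (suc r) * hermite b r * x) (w-suc r))
        where
        expand = solve 7 (λ b n m x y z w → z :* (b :* x :+ n :* (m :* y)) :* w :=
                   b :* (z :* x :* w) :+ z :* y :* (n :* (m :* w))) refl

      -- As series, V = a U + x W and W = b U + x V, so V = (a + b x)/(1-x²) U.
      V-⋆ : ∀ r → V r ≡ (alternating a b ⋆ U) r
      W-⋆ : ∀ r → W r ≡ (alternating b a ⋆ U) r
      V-⋆ zero    = solve 2 (λ a w → a :* con 1 :* w := a :* (con 1 :* con 1 :* w)) refl a (w 0)
      V-⋆ (suc r) = trans (V-suc r) (cong (a * U (suc r) +_) (W-⋆ r))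
      W-⋆ zero    = solve 2 (λ b w → con 1 :* b :* w := b :* (con 1 :* con 1 :* w)) refl b (w 0)
      W-⋆ (suc r) = trans (W-suc r) (cong (b * U (suc r) +_) (V-⋆ r))

      -- The Hermite recursion is applied to `A₂`, then to `B₂` only in the term with `A₀`. Of the
      -- two factors n (r+1) that arise, one is absorbed by `w`; in the other, n cancels against ν.
      U-step : ∀ r → θ U (2 ℕ.+ r) ≡ fromℕ (suc r) * U r + ν * (a * W (suc r) + b * W r)
      U-step r = begin
        fromℕ (2 ℕ.+ r) * (A₂ * B₂ * w (2 ℕ.+ r))
          ≡⟨ swap (fromℕ (2 ℕ.+ r)) A₂ B₂ (w (2 ℕ.+ r)) ⟩
        A₂ * B₂ * (fromℕ (2 ℕ.+ r) * w (2 ℕ.+ r))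
          ≡⟨ cong (A₂ * B₂ *_) (w-step (suc r)) ⟩
        A₂ * B₂ * (ν * w (suc r))
          ≡⟨ expand a n m A₁ A₀ B₂ ν (w (suc r)) ⟩
        ν * (a * W (suc r) + A₀ * B₂ * (n * (m * w (suc r))))
          ≡⟨ cong (λ x → ν * (a * W (suc r) + A₀ * B₂ * x)) (w-suc r) ⟩
        ν * (a * W (suc r) + A₀ * (b * B₁ + n * (m * B₀)) * w r)
          ≡⟨ regroup ν (W (suc r)) a b n m A₀ B₁ B₀ (w r) ⟩
        n * ν * (m * U r) + ν * (a * W (suc r) + b * W r)
          ≡⟨ cong (λ x → x * (m * U r) + ν * (a * W (suc r) + b * W r)) n*ν ⟩
        1# * (m * U r) + ν * (a * W (suc r) + b * W r)
          ≡⟨ +-congʳ (*-identityˡ _) ⟩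
        m * U r + ν * (a * W (suc r) + b * W r) ∎
        where
        m = fromℕ (suc r)
        A₀ = hermite a r
        A₁ = hermite a (suc r)
        A₂ = hermite a (2 ℕ.+ r)
        B₀ = hermite b r
        B₁ = hermite b (suc r)
        B₂ = hermite b (2 ℕ.+ r)
        swap = solve 4 (λ m x y z → m :* (x :* y :* z) := x :* y :* (m :* z)) refl
        expand = solve 8 (λ a n m x y z ν w → (a :* x :+ n :* (m :* y)) :* z :* (ν :* w) :=
                   ν :* (a :* (x :* z :* w) :+ y :* z :* (n :* (m :* w)))) refl
        regroup = solve 10 (λ ν W a b n m x y z w →
                    ν :* (a :* W :+ x :* (b :* y :+ n :* (m :* z)) :* w) :=
                    n :* ν :* (m :* (x :* z :* w)) :+ ν :* (a :* W :+ b :* (x :* y :* w))) refl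

      -- Lowering `W (suc r)` to `V r` brings both auxiliary series to the index r, where each is a
      -- known rational multiple of `U`.
      bilinear : ∀ r → ν * (a * W (suc r) + b * W r) ≡ a * b * ν * U (suc r) + (alternating σ τ ⋆ U) r
      bilinear r = begin
        ν * (a * W (suc r) + b * W r)
          ≡⟨ cong (λ x → ν * (a * x + b * W r)) (W-suc r) ⟩
        ν * (a * (b * U (suc r) + V r) + b * W r)
          ≡⟨ regroup ν a b (U (suc r)) (V r) (W r) ⟩
        a * b * ν * U (suc r) + (ν * a * V r + ν * b * W r)
          ≡⟨ cong₂ (λ x y → a * b * ν * U (suc r) + (ν * a * x + ν * b * y)) (V-⋆ r) (W-⋆ r) ⟩
        a * b * ν * U (suc r) + (ν * a * (alternating a b ⋆ U) r + ν * b * (alternating b a ⋆ U) r)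
          ≡⟨ +-congˡ (cong₂ _+_ (⋆-*ˡ (ν * a) (alternating a b) U r) (⋆-*ˡ (ν * b) (alternating b a) U r)) ⟨
        a * b * ν * U (suc r) + (((λ k → ν * a * alternating a b k) ⋆ U) r + ((λ k → ν * b * alternating b a k) ⋆ U) r)
          ≡⟨ +-congˡ (⋆-distribʳ _ _ U r) ⟨
        a * b * ν * U (suc r) + ((λ k → ν * a * alternating a b k + ν * b * alternating b a k) ⋆ U) r
          ≡⟨ +-congˡ (⋆-congˡ U coefficients r) ⟩
        a * b * ν * U (suc r) + (alternating σ τ ⋆ U) r ∎
        where
        regroup = solve 6 (λ ν a b u v w → ν :* (a :* (b :* u :+ v) :+ b :* w) :=
                    a :* b :* ν :* u :+ (ν :* a :* v :+ ν :* b :* w)) refl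
        coefficients : ∀ k → ν * a * alternating a b k + ν * b * alternating b a k ≡ alternating σ τ k
        coefficients k = begin
          ν * a * alternating a b k + ν * b * alternating b a k
            ≡⟨ cong₂ _+_ (alternating-* (ν * a) a b k) (alternating-* (ν * b) b a k) ⟩
          alternating (ν * a * a) (ν * a * b) k + alternating (ν * b * b) (ν * b * a) k
            ≡⟨ alternating-+ _ _ _ _ k ⟩
          alternating (ν * a * a + ν * b * b) (ν * a * b + ν * b * a) k
            ≡⟨ cong₂ (λ x y → alternating x y k)
                 (solve 3 (λ a b ν → ν :* a :* a :+ ν :* b :* b := (a :* a :+ b :* b) :* ν) refl a b ν)
                 (solve 3 (λ a b ν → ν :* a :* b :+ ν :* b :* a := a :* b :* ν :+ a :* b :* ν) refl a b ν) ⟩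
          alternating σ τ k ∎

      fromℕ-2+ : ∀ k → fromℕ (2 ℕ.+ k) ≡ (1# + 1#) + fromℕ k
      fromℕ-2+ k = trans (fromℕ-suc _) (trans (cong (1# +_) (fromℕ-suc k)) (sym (+-assoc _ _ _)))

      double-η : ∀ x → (1# + 1#) * (x * η) ≡ x * ν
      double-η x = trans (solve 2 (λ x η → con 2 :* (x :* η) := x :* (η :+ η)) refl x η) (cong (x *_) η+η)

      -- The coefficients e(k) of Mehler's exponent have period two from k = 1 on, so (k+2) e(k+2)
      -- exceeds k e(k) by 2 e(k+2), which is σ or τ by parity. The term `δ k` comes from `χ₀-step`.
      χ-step : ∀ k → χ (2 ℕ.+ k) ≡ (χ k + δ k) + alternating σ τ k
      χ-step zero    = begin
        1# + fromℕ 2 * ((a * a + b * b) * η)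
          ≡⟨ cong (λ x → 1# + x * ((a * a + b * b) * η)) (trans (fromℕ-2+ 0) (trans (cong ((1# + 1#) +_) fromℕ-zero) (+-identityʳ _))) ⟩
        1# + (1# + 1#) * ((a * a + b * b) * η)
          ≡⟨ cong (1# +_) (double-η (a * a + b * b)) ⟩
        1# + σ
          ≡⟨ cong (_+ σ) (trans (cong (_+ 1#) (trans (+-identityˡ _) (zeroʳ (fromℕ 0)))) (+-identityˡ 1#)) ⟨
        (0# + fromℕ 0 * 0# + 1#) + σ ∎
      χ-step (suc k) = begin
        x + fromℕ (3 ℕ.+ k) * y
          ≡⟨ cong (λ m → x + m * y) (fromℕ-2+ (suc k)) ⟩
        x + ((1# + 1#) + fromℕ (suc k)) * y
          ≡⟨ regroup x (fromℕ (suc k)) y ⟩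
        (x + fromℕ (suc k) * y + 0#) + (1# + 1#) * y
          ≡⟨ cong (x + fromℕ (suc k) * y + 0# +_) (alternating-* (1# + 1#) (a * b * ν) ((a * a + b * b) * η) k) ⟩
        (x + fromℕ (suc k) * y + 0#) + alternating ((1# + 1#) * (a * b * ν)) ((1# + 1#) * ((a * a + b * b) * η)) k
          ≡⟨ cong₂ (λ u v → (x + fromℕ (suc k) * y + 0#) + alternating u v k)
               (solve 1 (λ q → con 2 :* q := q :+ q) refl (a * b * ν)) (double-η (a * a + b * b)) ⟩
        (x + fromℕ (suc k) * y + 0#) + alternating τ σ k ∎
        where
        x = alternating 0# 1# k
        y = alternating (a * b * ν) ((a * a + b * b) * η) k
        regroup = solve 3 (λ x m y → x :+ (con 2 :+ m) :* y := (x :+ m :* y :+ con 0) :+ con 2 :* y) refl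

      χ-zero : χ 0 ≡ 0#
      χ-zero = trans (+-identityˡ _) (zeroʳ _)

      χ-one : χ 1 ≡ a * b * ν
      χ-one = trans (+-identityˡ _) (trans (cong (_* (a * b * ν)) fromℕ-1) (*-identityˡ _))

      -- Induction in steps of two: the term (r+1) `U r` of `U-step` is `U r` plus `θ U r`, the
      -- induction hypothesis rewrites the latter, and the total is the expansion of `χ ⋆ U` by
      -- `χ-step`.
      equation : ∀ r → θ U r ≡ (χ ⋆ U) r
      equation zero          = equation-zero U χ χ-zero
      equation (suc zero)    = begin
        fromℕ 1 * (a * b * w 1)
          ≡⟨ solve 4 (λ m a b w → m :* (a :* b :* w) := a :* b :* (m :* w)) refl (fromℕ 1) a b (w 1) ⟩
        a * b * (fromℕ 1 * w 1)
          ≡⟨ cong (a * b *_) (w-step 0) ⟩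
        a * b * (ν * w 0)
          ≡⟨ solve 5 (λ a b ν w u → a :* b :* (ν :* w) := con 0 :* u :+ a :* b :* ν :* (con 1 :* con 1 :* w))
               refl a b ν (w 0) (U 1) ⟩
        0# * U 1 + a * b * ν * U 0
          ≡⟨ cong₂ (λ x y → x * U 1 + y * U 0) χ-zero χ-one ⟨
        χ 0 * U 1 + χ 1 * U 0 ∎
      equation (suc (suc r)) = begin
        θ U (2 ℕ.+ r)
          ≡⟨ U-step r ⟩
        fromℕ (suc r) * U r + ν * (a * W (suc r) + b * W r)
          ≡⟨ cong₂ _+_ (trans (cong (_* U r) (fromℕ-suc r)) (distribʳ _ _ _)) (bilinear r) ⟩
        (1# * U r + θ U r) + (a * b * ν * U (suc r) + (alternating σ τ ⋆ U) r)
          ≡⟨ cong₂ (λ x y → (x + y) + (a * b * ν * U (suc r) + (alternating σ τ ⋆ U) r))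
               (trans (*-identityˡ _) (sym (Σℕ-δ r U))) (equation r) ⟩
        ((δ ⋆ U) r + (χ ⋆ U) r) + (a * b * ν * U (suc r) + (alternating σ τ ⋆ U) r)
          ≡⟨ regroup ((δ ⋆ U) r) ((χ ⋆ U) r) (a * b * ν * U (suc r)) ((alternating σ τ ⋆ U) r) (U (2 ℕ.+ r)) ⟩
        0# * U (2 ℕ.+ r) + (a * b * ν * U (suc r) + (((χ ⋆ U) r + (δ ⋆ U) r) + (alternating σ τ ⋆ U) r))
          ≡⟨ cong (λ z → 0# * U (2 ℕ.+ r) + (a * b * ν * U (suc r) + z)) shifted ⟨
        0# * U (2 ℕ.+ r) + (a * b * ν * U (suc r) + ((λ k → χ (2 ℕ.+ k)) ⋆ U) r)
          ≡⟨ cong₂ (λ x y → x * U (2 ℕ.+ r) + (y * U (suc r) + ((λ k → χ (2 ℕ.+ k)) ⋆ U) r)) χ-zero χ-one ⟨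
        (χ ⋆ U) (2 ℕ.+ r) ∎
        where
        regroup = solve 5 (λ d c u t z → (d :+ c) :+ (u :+ t) := con 0 :* z :+ (u :+ ((c :+ d) :+ t))) refl
        shifted : ((λ k → χ (2 ℕ.+ k)) ⋆ U) r ≡ ((χ ⋆ U) r + (δ ⋆ U) r) + (alternating σ τ ⋆ U) r
        shifted = begin
          ((λ k → χ (2 ℕ.+ k)) ⋆ U) r
            ≡⟨ ⋆-congˡ U χ-step r ⟩
          ((λ k → (χ k + δ k) + alternating σ τ k) ⋆ U) r
            ≡⟨ ⋆-distribʳ (λ k → χ k + δ k) (alternating σ τ) U r ⟩
          ((λ k → χ k + δ k) ⋆ U) r + (alternating σ τ ⋆ U) r
            ≡⟨ +-congʳ (⋆-distribʳ χ δ U r) ⟩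
          ((χ ⋆ U) r + (δ ⋆ U) r) + (alternating σ τ ⋆ U) r ∎

      mehler : IsLogDerivative₁ U χ
      mehler = record
        { unital   = trans (cong (1# * 1# *_) w-zero) (trans (*-identityʳ _) (*-identityˡ 1#))
        ; equation = equation
        }

-- Integers and reciprocals in ℚ

open import Data.Nat.Combinatorics using (_C_; nCk≡n!/k![n-k]!; k![n∸k]!∣n!)
open import Data.Rational using (ℚ; 0ℚ; 1ℚ; _+_; _*_; -_; _-_; toℚᵘ)
open import Data.Rational.Properties
open import Data.Rational.Solver
import Data.Rational.Unnormalised as ℚᵘ
import Data.Rational.Unnormalised.Properties as ℚᵘ

-- Normalized fractions are computed through a gcd; identities with a variable numerator are
-- therefore checked on unnormalised representatives.
toℚᵘ-fromℕ : ∀ n → toℚᵘ (fromℕ n) ℚᵘ.≃ ℚᵘ.mkℚᵘ (ℤ.+ n) 0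
toℚᵘ-fromℕ n = toℚᵘ-fromℚᵘ (ℚᵘ.mkℚᵘ (ℤ.+ n) 0)

fromℕ-suc : ∀ n → fromℕ (suc n) ≡ 1ℚ + fromℕ n
fromℕ-suc n = toℚᵘ-injective (ℚᵘ.≃-trans (toℚᵘ-fromℕ (suc n)) (ℚᵘ.≃-trans
  (ℚᵘ.*≡* (cong (λ x → (ℤ.+ 1 ℤ.+ x) ℤ.* ℤ.+ 1) (sym (ℤ.*-identityʳ (ℤ.+ n)))))
  (ℚᵘ.≃-sym (ℚᵘ.≃-trans (toℚᵘ-homo-+ 1ℚ (fromℕ n))
    (ℚᵘ.+-cong (ℚᵘ.≃-refl {toℚᵘ 1ℚ}) (toℚᵘ-fromℕ n))))))

fromℕ-* : ∀ m n → fromℕ (m ℕ.* n) ≡ fromℕ m * fromℕ n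
fromℕ-* m n = toℚᵘ-injective (ℚᵘ.≃-trans (toℚᵘ-fromℕ (m ℕ.* n)) (ℚᵘ.≃-trans
  (ℚᵘ.*≡* (cong (ℤ._* ℤ.+ 1) (ℤ.pos-* m n)))
  (ℚᵘ.≃-sym (ℚᵘ.≃-trans (toℚᵘ-homo-* (fromℕ m) (fromℕ n))
    (ℚᵘ.*-cong (toℚᵘ-fromℕ m) (toℚᵘ-fromℕ n))))))

recip-inverse : ∀ n .{{_ : NonZero n}} → fromℕ n * recip n ≡ 1ℚ
recip-inverse (suc n) = toℚᵘ-injective (ℚᵘ.≃-trans (toℚᵘ-homo-* (fromℕ (suc n)) (recip (suc n)))
  (ℚᵘ.≃-trans (ℚᵘ.*-cong (toℚᵘ-fromℕ (suc n)) (toℚᵘ-fromℚᵘ (ℚᵘ.mkℚᵘ (ℤ.+ 1) n)))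
  (ℚᵘ.*≡* (trans (ℤ.*-identityʳ _) (trans (ℤ.*-identityʳ _)
    (sym (trans (ℤ.*-identityˡ _) (cong (ℤ.+_ ∘ suc) (ℕ.+-identityʳ n)))))))))

*-cancelˡ-fromℕ : ∀ n .{{_ : NonZero n}} {x y} → fromℕ n * x ≡ fromℕ n * y → x ≡ y
*-cancelˡ-fromℕ n {x} {y} eq = trans (sym (undo x)) (trans (cong (recip n *_) eq) (undo y))
  where
  undo : ∀ z → recip n * (fromℕ n * z) ≡ z
  undo z = trans (sym (*-assoc (recip n) (fromℕ n) z))
    (trans (cong (_* z) (trans (*-comm (recip n) (fromℕ n)) (recip-inverse n))) (*-identityˡ z))

recip-* : ∀ m n .{{_ : NonZero m}} .{{_ : NonZero n}} → recip (m ℕ.* n) ≡ recip m * recip n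
recip-* m n = *-cancelˡ-fromℕ (m ℕ.* n) {{ℕ.m*n≢0 m n}} (begin
  fromℕ (m ℕ.* n) * recip (m ℕ.* n)              ≡⟨ recip-inverse (m ℕ.* n) {{ℕ.m*n≢0 m n}} ⟩
  1ℚ                                             ≡⟨ cong₂ _*_ (recip-inverse m) (recip-inverse n) ⟨
  (fromℕ m * recip m) * (fromℕ n * recip n)      ≡⟨ interchange (fromℕ m) (recip m) (fromℕ n) (recip n) ⟩
  (fromℕ m * fromℕ n) * (recip m * recip n)      ≡⟨ cong (_* (recip m * recip n)) (fromℕ-* m n) ⟨
  fromℕ (m ℕ.* n) * (recip m * recip n)          ∎)
  where
  open +-*-Solver
  interchange = solve 4 (λ a b c d → (a :* b) :* (c :* d) := (a :* c) :* (b :* d)) refl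

open SeriesAlgebra (IsCommutativeRing.isCommutativeSemiring +-*-isCommutativeRing)
  fromℕ refl fromℕ-suc (λ n → *-cancelˡ-fromℕ (suc n))
  hiding (_+_; _*_; commutativeSemiring; fromℕ-+; +-congˡ; +-congʳ; *-congˡ; +-interchange; *-interchange)

-- The defined operations in terms of the abstract ones

sumList-++ : ∀ xs ys → sumList (xs ++ ys) ≡ sumList xs + sumList ys
sumList-++ []       ys = sym (+-identityˡ (sumList ys))
sumList-++ (x ∷ xs) ys = trans (cong (x +_) (sumList-++ xs ys)) (sym (+-assoc x (sumList xs) (sumList ys)))

sumList-concatMap : ∀ {A B : Set} (h : B → ℚ) (k : A → List B) g n →
  sumList (map h (concatMap k (applyUpTo g n))) ≡ sumList (applyUpTo (λ i → sumList (map h (k (g i)))) n)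
sumList-concatMap h k g zero    = refl
sumList-concatMap h k g (suc n) = trans (cong sumList (map-++ h (k (g 0)) (concatMap k (applyUpTo (g ∘ suc) n))))
  (trans (sumList-++ (map h (k (g 0))) (map h (concatMap k (applyUpTo (g ∘ suc) n))))
    (cong (sumList (map h (k (g 0))) +_) (sumList-concatMap h k (g ∘ suc) n)))

-- As `suc a ∸ suc i` reduces to `a ∸ i`, shifting the index matches the recursion of `Σℕ`.
sumList-antidiagonal : ∀ a {f : ℕ → ℚ} F → (∀ i → f i ≡ F i (a ∸ i)) →
  sumList (applyUpTo f (suc a)) ≡ Σℕ F a
sumList-antidiagonal zero    {f} F eq = trans (+-identityʳ (f 0)) (eq 0)
sumList-antidiagonal (suc a) F eq = cong₂ _+_ (eq 0) (sumList-antidiagonal a (F ∘ suc) (eq ∘ suc))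

sumList-splits : ∀ r (h : Mono × Mono → ℚ) → sumList (map h (splits r)) ≡ Σᴹ (λ s t → h (s , t)) r
sumList-splits []      h = +-identityʳ (h ([] , []))
sumList-splits (a ∷ r) h = trans
  (sumList-concatMap h (λ i → map (λ { (s , t) → (i ∷ s , (a ∸ i) ∷ t) }) (splits r)) id (suc a))
  (sumList-antidiagonal a (λ i j → Σᴹ (λ s t → h (i ∷ s , j ∷ t)) r) (λ i →
    trans (cong sumList (sym (map-∘ {g = h} {f = λ { (s , t) → (i ∷ s , (a ∸ i) ∷ t) }} (splits r))))
      (sumList-splits r (λ { (s , t) → h (i ∷ s , (a ∸ i) ∷ t) }))))

*S≈⊛ : ∀ f g → f *S g ≈ f ⊛ g
*S≈⊛ f g r = sumList-splits r (λ { (s , t) → f s * g t })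

⊛-congʳ : ∀ f {g g′} → g ≈ g′ → f ⊛ g ≈ f ⊛ g′
⊛-congʳ f {g} {g′} eq = ⊛-cong {f} {f} {g} {g′} (λ _ → refl) eq

⊛-congˡ : ∀ {f f′} g → f ≈ f′ → f ⊛ g ≈ f′ ⊛ g
⊛-congˡ {f} {f′} g eq = ⊛-cong {f} {f′} {g} {g} eq (λ _ → refl)

*S≈⊛-cong : ∀ {f f′ g g′} → f ≈ f′ → g ≈ g′ → f *S g ≈ f′ ⊛ g′
*S≈⊛-cong {f} {f′} {g} {g′} ef eg r = trans (*S≈⊛ f g r) (⊛-cong {f} {f′} {g} {g′} ef eg r)

powS≈pow : ∀ f k → powS f k ≈ pow f k
powS≈pow f zero    r = refl
powS≈pow f (suc k) = *S≈⊛-cong {f} {f} {powS f k} {pow f k} (λ _ → refl) (powS≈pow f k)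

sumTo≡Σ≤ : ∀ n f → sumTo n f ≡ Σ≤ n f
sumTo≡Σ≤ zero    f = refl
sumTo≡Σ≤ (suc n) f = cong (_+ f (suc n)) (sumTo≡Σ≤ n f)

sum1To≡Σ< : ∀ n f → sum1To n f ≡ Σ< n (f ∘ suc)
sum1To≡Σ< zero    f = refl
sum1To≡Σ< (suc n) f = trans (first n f) (cong (f 1 +_) (sum1To≡Σ< n (f ∘ suc)))
  where
  first : ∀ n f → sum1To (suc n) f ≡ f 1 + sum1To n (f ∘ suc)
  first zero    f = +-comm 0ℚ (f 1)
  first (suc n) f = trans (cong (_+ f (suc (suc n))) (first n f)) (+-assoc (f 1) (sum1To n (f ∘ suc)) (f (suc (suc n))))

deg≤wdeg′ : ∀ i r → deg r ≤ wdeg′ (suc i) r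
deg≤wdeg′ i []      = z≤n
deg≤wdeg′ i (a ∷ r) = ℕ.+-mono-≤ (ℕ.m≤m+n a (i ℕ.* a)) (deg≤wdeg′ (suc i) r)

recip-!-suc : ∀ k → fromℕ (suc k) * recip (suc k !) ≡ recip (k !)
recip-!-suc k = begin
  fromℕ (suc k) * recip (suc k !)                 ≡⟨ cong (fromℕ (suc k) *_) (recip-* (suc k) (k !) {{_}} {{k ℕ.!≢0}}) ⟩
  fromℕ (suc k) * (recip (suc k) * recip (k !))   ≡⟨ *-assoc (fromℕ (suc k)) (recip (suc k)) (recip (k !)) ⟨
  fromℕ (suc k) * recip (suc k) * recip (k !)     ≡⟨ cong (_* recip (k !)) (recip-inverse (suc k)) ⟩
  1ℚ * recip (k !)                                ≡⟨ *-identityˡ (recip (k !)) ⟩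
  recip (k !)                                     ∎

expS≈compose : ∀ f → Vanishing f → expS f ≈ compose (λ k → recip (k !)) f
expS≈compose f f0 r = begin
  sumTo (wdeg r) (λ k → recip (k !) * powS f k r)
    ≡⟨ sumTo≡Σ≤ (wdeg r) (λ k → recip (k !) * powS f k r) ⟩
  Σ≤ (wdeg r) (λ k → recip (k !) * powS f k r)
    ≡⟨ Σ≤-cong (wdeg r) (λ k → cong (recip (k !) *_) (powS≈pow f k r)) ⟩
  Σ≤ (wdeg r) (λ k → recip (k !) * pow f k r)
    ≡⟨ compose-stable (λ k → recip (k !)) f f0 (wdeg r) r (deg≤wdeg′ 0 r) ⟩
  compose (λ k → recip (k !)) f r ∎

invS≈geometric : ∀ f → Vanishing (oneS -S f) → invS f ≈ geometric (oneS -S f)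
invS≈geometric f φ0 r = begin
  sumTo (wdeg r) (λ k → powS φ k r)      ≡⟨ sumTo≡Σ≤ (wdeg r) (λ k → powS φ k r) ⟩
  Σ≤ (wdeg r) (λ k → powS φ k r)
    ≡⟨ Σ≤-cong (wdeg r) (λ k → trans (powS≈pow φ k r) (sym (*-identityˡ (pow φ k r)))) ⟩
  Σ≤ (wdeg r) (λ k → 1ℚ * pow φ k r)     ≡⟨ compose-stable (λ _ → 1ℚ) φ φ0 (wdeg r) r (deg≤wdeg′ 0 r) ⟩
  geometric φ r                          ∎
  where φ = oneS -S f

-- With ψ = 1 - f, both `invS f` and `d` solve d = 1 + ψ d, and the solution is unique.
invS-unique : ∀ {f ψ d} → oneS -S f ≈ ψ → Vanishing ψ → d ≈ one ⊕ (ψ ⊛ d) → invS f ≈ d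
invS-unique {f} {ψ} {d} φ≈ψ ψ0 fix = fixpoint-unique {ψ} {invS f} {d} ψ0 (λ r eq → begin
  invS f r                          ≡⟨ inv≈ r ⟩
  geometric φ r                     ≡⟨ geometric-fixpoint φ φ0 r ⟩
  one r + (φ ⊛ geometric φ) r       ≡⟨ cong (one r +_) (⊛-cong {φ} {ψ} {geometric φ} {invS f} φ≈ψ (sym ∘ inv≈) r) ⟩
  one r + (ψ ⊛ invS f) r            ≡⟨ cong (one r +_) eq ⟩
  one r + (ψ ⊛ d) r                 ≡⟨ fix r ⟨
  d r                               ∎)
  where
  φ = oneS -S f
  φ0 : Vanishing φ
  φ0 r e = trans (φ≈ψ r) (ψ0 r e)
  inv≈ = invS≈geometric f φ0

-- With φ = 1 - f, the inverse equals both φ f⁻¹ + f f⁻¹ and φ f⁻¹ + 1; the common term cancels.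
⊛-invS : ∀ f → Unital f → f ⊛ invS f ≈ one
⊛-invS f f1 r = ∙-cancelˡ ((φ ⊛ invS f) r) ((f ⊛ invS f) r) (one r) (begin
  (φ ⊛ invS f) r + (f ⊛ invS f) r   ≡⟨ ⊛-distribʳ φ f (invS f) r ⟨
  ((φ ⊕ f) ⊛ invS f) r              ≡⟨ ⊛-congˡ {φ ⊕ f} {one} (invS f) (λ s → minus-plus (one s) (f s)) r ⟩
  (one ⊛ invS f) r                  ≡⟨ ⊛-identityˡ (invS f) r ⟩
  invS f r                          ≡⟨ inv≈ r ⟩
  geometric φ r                     ≡⟨ geometric-fixpoint φ φ0 r ⟩
  one r + (φ ⊛ geometric φ) r       ≡⟨ cong (one r +_) (⊛-congʳ φ {geometric φ} {invS f} (sym ∘ inv≈) r) ⟩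
  one r + (φ ⊛ invS f) r            ≡⟨ +-comm (one r) ((φ ⊛ invS f) r) ⟩
  (φ ⊛ invS f) r + one r            ∎)
  where
  open import Algebra.Properties.Group +-0-group using (∙-cancelˡ)
  open +-*-Solver
  φ = oneS -S f
  φ0 : Vanishing φ
  φ0 r e = trans (cong₂ _-_ (one-deg0 r e) (f1 r e)) (+-inverseʳ 1ℚ)
  inv≈ = invS≈geometric f φ0
  minus-plus : ∀ x y → (x - y) + y ≡ x
  minus-plus = solve 2 (λ x y → (x :- y) :+ y := x) refl

*S-invS-unique : ∀ {f g} h → h ⊛ g ≈ f → Unital g → f *S invS g ≈ h
*S-invS-unique {f} {g} h eq g1 r = begin
  (f *S invS g) r          ≡⟨ *S≈⊛ f (invS g) r ⟩
  (f ⊛ invS g) r           ≡⟨ ⊛-congˡ {h ⊛ g} {f} (invS g) eq r ⟨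
  ((h ⊛ g) ⊛ invS g) r     ≡⟨ ⊛-assoc h g (invS g) r ⟩
  (h ⊛ (g ⊛ invS g)) r     ≡⟨ ⊛-congʳ h {g ⊛ invS g} {one} (⊛-invS g g1) r ⟩
  (h ⊛ one) r              ≡⟨ ⊛-identityʳ h r ⟩
  h r                      ∎

sumS≈separated : ∀ F φ → (∀ m → F (suc m) ≈ inVar m (φ m)) → (∀ m → φ m 0 ≡ 0ℚ) → sumS F ≈ separated φ
sumS≈separated F φ eq φ0 r = begin
  sum1To (wdeg r) (λ n → F n r)               ≡⟨ sum1To≡Σ< (wdeg r) (λ n → F n r) ⟩
  Σ< (wdeg r) (λ m → F (suc m) r)             ≡⟨ Σ<-cong (wdeg r) (λ m → eq m r) ⟩
  Σ< (wdeg r) (λ m → inVar m (φ m) r)         ≡⟨ Σ<-inVar (wdeg r) 0 φ φ0 r (ℕ.n<1+n (wdeg r)) ⟩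
  separated φ r                               ∎

expS-logDerivative : ∀ {Φ} φ → Φ ≈ separated φ → (∀ m → φ m 0 ≡ 0ℚ) →
  IsLogDerivative (expS Φ) (separated (θ ∘ φ))
expS-logDerivative {Φ} φ Φ≈φ φ0 = logDerivative-cong {compose (λ k → recip (k !)) Φ} {expS Φ} {D Φ}
  (sym ∘ expS≈compose Φ Φ0) DΦ≈
  (exp-logDerivative (λ k → recip (k !)) Φ Φ0 refl recip-!-suc)
  where
  Φ0 : Vanishing Φ
  Φ0 r e = trans (Φ≈φ r) (separated-vanishing φ φ0 r e)
  DΦ≈ : D Φ ≈ separated (θ ∘ φ)
  DΦ≈ r = trans (cong (fromℕ (deg r) *_) (Φ≈φ r)) (D-separated φ r)

-- Fractions in a single power sum

p≈inVar : ∀ m → p (suc m) ≈ inVar m (monomial 1)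
p≈inVar m       []                = refl
p≈inVar zero    (0 ∷ r)           = sym (*-zeroˡ (one r))
p≈inVar zero    (1 ∷ r)           = sym (*-identityˡ (one r))
p≈inVar zero    (suc (suc a) ∷ r) = sym (*-zeroˡ (one r))
p≈inVar (suc m) (0 ∷ r)           = trans (p≈inVar m r) (sym (*-identityˡ (inVar m (monomial 1) r)))
p≈inVar (suc m) (suc a ∷ r)       = sym (*-zeroˡ (inVar m (monomial 1) r))

powS-p≈inVar : ∀ m k → powS (p (suc m)) k ≈ inVar m (monomial k)
powS-p≈inVar m k r = trans (powS≈pow (p (suc m)) k r) (pow-inVar m k (p≈inVar m) r)

scaleS≈inVar : ∀ m x {f c d} → f ≈ inVar m c → (∀ a → x * c a ≡ d a) → scaleS x f ≈ inVar m d
scaleS≈inVar m x {f} {c} {d} f≈c eq r =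
  trans (cong (x *_) (f≈c r)) (trans (inVar-*ˡ m x c r) (inVar-cong m eq r))

zeroS≈inVar : ∀ m {c} → (∀ a → c a ≡ 0ℚ) → zeroS ≈ inVar m c
zeroS≈inVar m {c} c≡0 r = trans (sym (*-zeroˡ (inVar m δ r)))
  (scaleS≈inVar m 0ℚ {inVar m δ} {δ} {c} (λ _ → refl) (λ a → trans (*-zeroˡ (δ a)) (sym (c≡0 a))) r)

-- The coefficients `d` of the inverse are guessed by the caller and confirmed by their fixed-point
-- equation.
*S-invS≈inVar : ∀ m {x f ξ ψ} d → x ≈ inVar m ξ → oneS -S f ≈ inVar m ψ → ψ 0 ≡ 0ℚ →
  (∀ a → d a ≡ δ a + (ψ ⋆ d) a) → x *S invS f ≈ inVar m (ξ ⋆ d)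
*S-invS≈inVar m {x} {f} {ξ} {ψ} d x≈ξ f≈ψ ψ0 fix r = trans
  (*S≈⊛-cong {x} {inVar m ξ} {invS f} {inVar m d} x≈ξ
    (invS-unique {f} {inVar m ψ} {inVar m d} f≈ψ (inVar-vanishing m ψ ψ0) fixS) r)
  (inVar-⊛ m ξ d r)
  where
  fixS : inVar m d ≈ one ⊕ (inVar m ψ ⊛ inVar m d)
  fixS r = begin
    inVar m d r                              ≡⟨ inVar-cong m fix r ⟩
    inVar m (λ a → δ a + (ψ ⋆ d) a) r        ≡⟨ inVar-⊕ m δ (ψ ⋆ d) r ⟨
    inVar m δ r + inVar m (ψ ⋆ d) r          ≡⟨ cong₂ _+_ (inVar-δ m r) (sym (inVar-⊛ m ψ d r)) ⟩
    one r + (inVar m ψ ⊛ inVar m d) r        ∎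

one-minus-one-minus : ∀ f → oneS -S (oneS -S f) ≈ f
one-minus-one-minus f r = solve 2 (λ x y → x :- (x :- y) := y) refl (one r) (f r)
  where open +-*-Solver

p/[1-p] : ∀ m → p (suc m) *S geomInv (p (suc m)) ≈ inVar m (delayed 1ℚ 1ℚ)
p/[1-p] m r = trans (*S-invS≈inVar m {ξ = monomial 1} {monomial 1} d (p≈inVar m)
    (λ s → trans (one-minus-one-minus (p (suc m)) s) (p≈inVar m s)) refl fix r)
  (inVar-cong m coefficients r)
  where
  d = alternating 1ℚ 1ℚ
  fix : ∀ a → d a ≡ δ a + (monomial 1 ⋆ d) a
  fix zero    = refl
  fix (suc a) = sym (trans (+-identityˡ ((monomial 1 ⋆ d) (suc a))) (monomial-1-⋆-suc d a))
  coefficients : ∀ a → (monomial 1 ⋆ d) a ≡ delayed 1ℚ 1ℚ a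
  coefficients zero    = refl
  coefficients (suc a) = monomial-1-⋆-suc d a

p²/[1-p²] : ∀ m → powS (p (suc m)) 2 *S geomInv (powS (p (suc m)) 2) ≈ inVar m (delayed 0ℚ 1ℚ)
p²/[1-p²] m r = trans (*S-invS≈inVar m {ξ = monomial 2} {monomial 2} d (powS-p≈inVar m 2)
    (λ s → trans (one-minus-one-minus (powS (p (suc m)) 2) s) (powS-p≈inVar m 2 s)) refl fix r)
  (inVar-cong m coefficients r)
  where
  d = alternating 1ℚ 0ℚ
  monomial-2-⋆ : ∀ a → (monomial 2 ⋆ d) (suc (suc a)) ≡ d a
  monomial-2-⋆ a = trans (monomial-suc-⋆-suc 1 d (suc a)) (monomial-1-⋆-suc d a)
  fix : ∀ a → d a ≡ δ a + (monomial 2 ⋆ d) a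
  fix zero          = refl
  fix (suc zero)    = refl
  fix (suc (suc a)) = sym (trans (+-identityˡ ((monomial 2 ⋆ d) (suc (suc a)))) (monomial-2-⋆ a))
  coefficients : ∀ a → (monomial 2 ⋆ d) a ≡ delayed 0ℚ 1ℚ a
  coefficients zero          = refl
  coefficients (suc zero)    = refl
  coefficients (suc (suc a)) = monomial-2-⋆ a

p/[1+p] : ∀ m → p (suc m) *S invS (oneS +S p (suc m)) ≈ inVar m (delayed 1ℚ (- 1ℚ))
p/[1+p] m r = trans (*S-invS≈inVar m {ξ = monomial 1} {ψ} d (p≈inVar m) minus-p refl fix r)
  (inVar-cong m coefficients r)
  where
  open +-*-Solver
  d = alternating 1ℚ (- 1ℚ)
  ψ : ℕ → ℚ
  ψ a = - 1ℚ * monomial 1 a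
  minus-p : oneS -S (oneS +S p (suc m)) ≈ inVar m ψ
  minus-p s = begin
    one s - (one s + p (suc m) s)
      ≡⟨ solve 2 (λ x y → x :- (x :+ y) := con (- 1ℚ) :* y) refl (one s) (p (suc m) s) ⟩
    - 1ℚ * p (suc m) s
      ≡⟨ scaleS≈inVar m (- 1ℚ) {p (suc m)} {monomial 1} {ψ} (p≈inVar m) (λ _ → refl) s ⟩
    inVar m ψ s ∎
  fix : ∀ a → d a ≡ δ a + (ψ ⋆ d) a
  fix zero    = refl
  fix (suc a) = begin
    alternating (- 1ℚ) 1ℚ a                    ≡⟨ alternating-* (- 1ℚ) 1ℚ (- 1ℚ) a ⟨
    - 1ℚ * d a                                 ≡⟨ cong (- 1ℚ *_) (monomial-1-⋆-suc d a) ⟨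
    - 1ℚ * (monomial 1 ⋆ d) (suc a)            ≡⟨ ⋆-*ˡ (- 1ℚ) (monomial 1) d (suc a) ⟨
    (ψ ⋆ d) (suc a)                            ≡⟨ +-identityˡ ((ψ ⋆ d) (suc a)) ⟨
    0ℚ + (ψ ⋆ d) (suc a)                       ∎
  coefficients : ∀ a → (monomial 1 ⋆ d) a ≡ delayed 1ℚ (- 1ℚ) a
  coefficients zero    = refl
  coefficients (suc a) = monomial-1-⋆-suc d a

-- Central binomial coefficients and the series G

double≡2* : ∀ k → double k ≡ 2 ℕ.* k
double≡2* zero    = refl
double≡2* (suc k) = cong suc (trans (cong suc (double≡2* k)) (sym (ℕ.+-suc k (k ℕ.+ 0))))

C-factorials : ∀ {n k} → k ≤ n → (n C k) ℕ.* (k ! ℕ.* (n ∸ k) !) ≡ n !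
C-factorials {n} {k} k≤n = trans (cong (ℕ._* (k ! ℕ.* (n ∸ k) !)) (nCk≡n!/k![n-k]! k≤n))
  (ℕ.m/n*n≡m {{k ℕ.!* (n ∸ k) !≢0}} (k![n∸k]!∣n! k≤n))

centralBinomial : ℕ → ℕ
centralBinomial k = (2 ℕ.* k) C k

centralBinomial-factorials : ∀ k → centralBinomial k ℕ.* (k ! ℕ.* k !) ≡ double k !
centralBinomial-factorials k = begin
  centralBinomial k ℕ.* (k ! ℕ.* k !)                  ≡⟨ cong (λ j → centralBinomial k ℕ.* (k ! ℕ.* j !)) 2k∸k ⟨
  centralBinomial k ℕ.* (k ! ℕ.* (2 ℕ.* k ∸ k) !)      ≡⟨ C-factorials (ℕ.m≤m+n k (k ℕ.+ 0)) ⟩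
  (2 ℕ.* k) !                                          ≡⟨ cong _! (double≡2* k) ⟨
  double k !                                           ∎
  where
  2k∸k : 2 ℕ.* k ∸ k ≡ k
  2k∸k = trans (ℕ.m+n∸m≡n k (k ℕ.+ 0)) (ℕ.+-identityʳ k)

-- After multiplication by (k+1) k!² both sides are (2k+2)!.
centralBinomial-suc : ∀ k →
  centralBinomial (suc k) ℕ.* suc k ≡ 2 ℕ.* (suc (double k) ℕ.* centralBinomial k)
centralBinomial-suc k = ℕ.*-cancelʳ-≡ _ _ (suc k ℕ.* (k ! ℕ.* k !))
  {{ℕ.m*n≢0 (suc k) (k ! ℕ.* k !) {{_}} {{k ℕ.!* k !≢0}}}} (begin
  b′ ℕ.* suc k ℕ.* (suc k ℕ.* (f ℕ.* f))
    ≡⟨ solve 3 (λ b s f → b :* s :* (s :* (f :* f)) := b :* ((s :* f) :* (s :* f))) refl b′ (suc k) f ⟩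
  b′ ℕ.* (suc k ! ℕ.* suc k !)
    ≡⟨ centralBinomial-factorials (suc k) ⟩
  double (suc k) ℕ.* (suc d ℕ.* d !)
    ≡⟨ cong₂ (λ x y → x ℕ.* (suc d ℕ.* y)) (double≡2* (suc k)) (sym (centralBinomial-factorials k)) ⟩
  2 ℕ.* suc k ℕ.* (suc d ℕ.* (b ℕ.* (f ℕ.* f)))
    ≡⟨ solve 4 (λ s d b f → con 2 :* s :* (d :* (b :* (f :* f))) := con 2 :* (d :* b) :* (s :* (f :* f)))
         refl (suc k) (suc d) b f ⟩
  2 ℕ.* (suc d ℕ.* b) ℕ.* (suc k ℕ.* (f ℕ.* f)) ∎)
  where
  open Data.Nat.Solver.+-*-Solver
  b = centralBinomial k
  b′ = centralBinomial (suc k)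
  d = double k
  f = k !

-- The coefficients of (1-x²)^{-1/2}.
γ : ℕ → ℚ
γ zero          = 1ℚ
γ (suc zero)    = 0ℚ
γ (suc (suc a)) = recip (2 ℕ.+ a) * (fromℕ (suc a) * γ a)

γ-step : ∀ a → fromℕ (2 ℕ.+ a) * γ (2 ℕ.+ a) ≡ fromℕ (suc a) * γ a
γ-step a = begin
  fromℕ (2 ℕ.+ a) * (recip (2 ℕ.+ a) * x)   ≡⟨ *-assoc (fromℕ (2 ℕ.+ a)) (recip (2 ℕ.+ a)) x ⟨
  fromℕ (2 ℕ.+ a) * recip (2 ℕ.+ a) * x     ≡⟨ cong (_* x) (recip-inverse (2 ℕ.+ a)) ⟩
  1ℚ * x                                    ≡⟨ *-identityˡ x ⟩
  x                                         ∎
  where x = fromℕ (suc a) * γ a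

γ-odd : ∀ k → γ (suc (double k)) ≡ 0ℚ
γ-odd zero    = refl
γ-odd (suc k) = begin
  recip (3 ℕ.+ d) * (fromℕ (2 ℕ.+ d) * γ (suc d))  ≡⟨ cong (λ x → recip (3 ℕ.+ d) * (fromℕ (2 ℕ.+ d) * x)) (γ-odd k) ⟩
  recip (3 ℕ.+ d) * (fromℕ (2 ℕ.+ d) * 0ℚ)         ≡⟨ cong (recip (3 ℕ.+ d) *_) (*-zeroʳ (fromℕ (2 ℕ.+ d))) ⟩
  recip (3 ℕ.+ d) * 0ℚ                             ≡⟨ *-zeroʳ (recip (3 ℕ.+ d)) ⟩
  0ℚ                                               ∎
  where d = double k

-- The ratio 2(2k+1)/(k+1) of consecutive central binomials, divided by 4, is the ratio
-- (2k+1)/(2k+2) in the recursion of `γ`.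
γ-even : ∀ k → fromℕ (centralBinomial k) * recip (4 ^ k) ≡ γ (double k)
γ-even zero    = refl
γ-even (suc k) = *-cancelˡ-fromℕ (2 ℕ.+ d) (begin
  fromℕ (2 ℕ.+ d) * (fromℕ b′ * recip (4 ℕ.* 4 ^ k))
    ≡⟨ cong₂ (λ x y → x * (fromℕ b′ * y))
         (trans (cong fromℕ (double≡2* (suc k))) (fromℕ-* 2 (suc k)))
         (recip-* 4 (4 ^ k) {{_}} {{ℕ.m^n≢0 4 k}}) ⟩
  fromℕ 2 * fromℕ (suc k) * (fromℕ b′ * (recip 4 * q))
    ≡⟨ solve 3 (λ s b q → con (fromℕ 2) :* s :* (b :* (con (recip 4) :* q)) := b :* s :* (con (recip 2) :* q))
         refl (fromℕ (suc k)) (fromℕ b′) q ⟩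
  fromℕ b′ * fromℕ (suc k) * (recip 2 * q)
    ≡⟨ cong (_* (recip 2 * q)) (fromℕ-* b′ (suc k)) ⟨
  fromℕ (b′ ℕ.* suc k) * (recip 2 * q)
    ≡⟨ cong (λ n → fromℕ n * (recip 2 * q)) (centralBinomial-suc k) ⟩
  fromℕ (2 ℕ.* (suc d ℕ.* b)) * (recip 2 * q)
    ≡⟨ cong (_* (recip 2 * q)) (trans (fromℕ-* 2 (suc d ℕ.* b)) (cong (fromℕ 2 *_) (fromℕ-* (suc d) b))) ⟩
  fromℕ 2 * (fromℕ (suc d) * fromℕ b) * (recip 2 * q)
    ≡⟨ solve 3 (λ d b q → con (fromℕ 2) :* (d :* b) :* (con (recip 2) :* q) := d :* (b :* q))
         refl (fromℕ (suc d)) (fromℕ b) q ⟩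
  fromℕ (suc d) * (fromℕ b * q)
    ≡⟨ cong (fromℕ (suc d) *_) (γ-even k) ⟩
  fromℕ (suc d) * γ d
    ≡⟨ γ-step d ⟨
  fromℕ (2 ℕ.+ d) * γ (2 ℕ.+ d) ∎)
  where
  open +-*-Solver
  d = double k
  b = centralBinomial k
  b′ = centralBinomial (suc k)
  q = recip (4 ^ k)

invSqrt≈inVar : ∀ m → invSqrt (suc m) ≈ inVar m γ
invSqrt≈inVar m r = begin
  sumTo n (λ k → fromℕ (centralBinomial k) * recip (4 ^ k) * powS (p (suc m)) (2 ℕ.* k) r)
    ≡⟨ sumTo≡Σ≤ n (λ k → fromℕ (centralBinomial k) * recip (4 ^ k) * powS (p (suc m)) (2 ℕ.* k) r) ⟩
  Σ≤ n (λ k → fromℕ (centralBinomial k) * recip (4 ^ k) * powS (p (suc m)) (2 ℕ.* k) r)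
    ≡⟨ Σ≤-cong n term ⟩
  Σ≤ n (λ k → inVar m (c k) r)
    ≡⟨ Σ≤-inVar n m c r ⟩
  inVar m (λ a → Σ≤ n (λ k → c k a)) r
    ≡⟨ inVar-cong-≤ m r (λ a a≤ → Σ≤-even-monomials n a γ (ℕ.≤-trans a≤ (deg≤wdeg′ 0 r)) γ-odd) ⟩
  inVar m γ r ∎
  where
  n = wdeg r
  c : ℕ → ℕ → ℚ
  c k a = γ (double k) * monomial (double k) a
  term : ∀ k → fromℕ (centralBinomial k) * recip (4 ^ k) * powS (p (suc m)) (2 ℕ.* k) r ≡ inVar m (c k) r
  term k = begin
    fromℕ (centralBinomial k) * recip (4 ^ k) * powS (p (suc m)) (2 ℕ.* k) r
      ≡⟨ cong₂ (λ x j → x * powS (p (suc m)) j r) (γ-even k) (sym (double≡2* k)) ⟩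
    γ (double k) * powS (p (suc m)) (double k) r
      ≡⟨ cong (γ (double k) *_) (powS-p≈inVar m (double k) r) ⟩
    γ (double k) * inVar m (monomial (double k)) r
      ≡⟨ inVar-*ˡ m (γ (double k)) (monomial (double k)) r ⟩
    inVar m (c k) r ∎

prodUpTo≈Π≤ : ∀ n {F F′} → (∀ m → F (suc m) ≈ F′ m) → prodUpTo n F ≈ Π≤ n F′
prodUpTo≈Π≤ zero    eq r = refl
prodUpTo≈Π≤ (suc n) {F} {F′} eq =
  *S≈⊛-cong {prodUpTo n F} {Π≤ n F′} {F (suc n)} {F′ n} (prodUpTo≈Π≤ n eq) (eq n)

G≈factored : G ≈ factored (λ _ → γ)
G≈factored r = trans (prodUpTo≈Π≤ (wdeg r) invSqrt≈inVar r)
  (Π≤-inVar (wdeg r) 0 (λ _ → γ) (λ _ → refl) r (ℕ.n<1+n (wdeg r)))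

G-logDerivative : IsLogDerivative G (separated (λ _ → χ₀))
G-logDerivative = logDerivative-cong {factored (λ _ → γ)} {G} {separated (λ _ → χ₀)} {separated (λ _ → χ₀)}
  (sym ∘ G≈factored) (λ _ → refl)
  (logDerivative-factored (λ _ → invSqrt-logDerivative γ refl refl γ-step))

-- Kronecker products of factored series

-- z m r is the factor of z_λ contributed by r parts equal to m + 1.
z w : ℕ → ℕ → ℚ
z m r = fromℕ (suc m ^ r ℕ.* r !)
w m r = recip (suc m ^ r ℕ.* r !)

n^r*r!≢0 : ∀ m r → NonZero (suc m ^ r ℕ.* r !)
n^r*r!≢0 m r = ℕ.m*n≢0 (suc m ^ r) (r !) {{ℕ.m^n≢0 (suc m) r}} {{r ℕ.!≢0}}

w-suc : ∀ m r → fromℕ (suc m) * (fromℕ (suc r) * w m (suc r)) ≡ w m r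
w-suc m r = begin
  fromℕ (suc m) * (fromℕ (suc r) * recip (suc m ^ suc r ℕ.* suc r !))
    ≡⟨ cong (λ x → fromℕ (suc m) * (fromℕ (suc r) * x)) (trans (cong recip rearrange)
         (trans (recip-* (suc m) (suc r ℕ.* n) {{_}} {{ℕ.m*n≢0 (suc r) n {{_}} {{n^r*r!≢0 m r}}}})
           (cong (recip (suc m) *_) (recip-* (suc r) n {{_}} {{n^r*r!≢0 m r}})))) ⟩
  fromℕ (suc m) * (fromℕ (suc r) * (recip (suc m) * (recip (suc r) * w m r)))
    ≡⟨ regroup (fromℕ (suc m)) (fromℕ (suc r)) (recip (suc m)) (recip (suc r)) (w m r) ⟩
  (fromℕ (suc m) * recip (suc m)) * ((fromℕ (suc r) * recip (suc r)) * w m r)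
    ≡⟨ cong₂ (λ x y → x * (y * w m r)) (recip-inverse (suc m)) (recip-inverse (suc r)) ⟩
  1ℚ * (1ℚ * w m r)
    ≡⟨ trans (*-identityˡ (1ℚ * w m r)) (*-identityˡ (w m r)) ⟩
  w m r ∎
  where
  n = suc m ^ r ℕ.* r !
  rearrange : suc m ^ suc r ℕ.* suc r ! ≡ suc m ℕ.* (suc r ℕ.* n)
  rearrange = solve 4 (λ m r x y → (m :* x) :* (r :* y) := m :* (r :* (x :* y))) refl (suc m) (suc r) (suc m ^ r) (r !)
    where open Data.Nat.Solver.+-*-Solver
  open +-*-Solver
  regroup = solve 5 (λ a b c d e → a :* (b :* (c :* (d :* e))) := (a :* c) :* ((b :* d) :* e)) refl

module Var (m : ℕ) = Hermite (fromℕ (suc m)) (recip (suc m)) (recip-inverse (suc m)) (w m) refl (w-suc m)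

zλ-factored : ∀ r → fromℕ (zλ r) ≡ factored z r
zλ-factored = from 0
  where
  from : ∀ i r → fromℕ (zλ′ (suc i) r) ≡ factored (λ m → z (i ℕ.+ m)) r
  from i []      = refl
  from i (a ∷ r) = trans (fromℕ-* (suc i ^ a ℕ.* a !) (zλ′ (2 ℕ.+ i) r))
    (cong₂ _*_ (cong (λ j → z j a) (sym (ℕ.+-identityʳ i)))
      (trans (from (suc i) r) (factored-cong (λ m b → cong (λ j → z j b) (sym (ℕ.+-suc i m))) r)))

⊗-factored : ∀ {f g c d} e → f ≈ factored c → g ≈ factored d →
  (∀ m r → z m r * (c m r * d m r) ≡ e m r) → f ⊗ g ≈ factored e
⊗-factored {f} {g} {c} {d} e f≈c g≈d eq r = begin
  fromℕ (zλ r) * (f r * g r)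
    ≡⟨ cong₂ _*_ (zλ-factored r) (trans (cong₂ _*_ (f≈c r) (g≈d r)) (factored-* c d r)) ⟩
  factored z r * factored (λ m a → c m a * d m a) r
    ≡⟨ factored-* z (λ m a → c m a * d m a) r ⟩
  factored (λ m a → z m a * (c m a * d m a)) r
    ≡⟨ factored-cong eq r ⟩
  factored e r ∎

-- One of the two weights 1/(n^r r!) cancels against z, so the product again carries a single
-- weight.
z-w-w : ∀ m r x y → z m r * ((x * w m r) * (y * w m r)) ≡ x * y * w m r
z-w-w m r x y = begin
  z m r * ((x * w m r) * (y * w m r))   ≡⟨ regroup (z m r) (w m r) x y ⟩
  z m r * w m r * (x * y * w m r)       ≡⟨ cong (_* (x * y * w m r)) (recip-inverse (suc m ^ r ℕ.* r !) {{n^r*r!≢0 m r}}) ⟩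
  1ℚ * (x * y * w m r)                  ≡⟨ *-identityˡ (x * y * w m r) ⟩
  x * y * w m r                         ∎
  where
  open +-*-Solver
  regroup = solve 4 (λ z w x y → z :* ((x :* w) :* (y :* w)) := z :* w :* (x :* y :* w)) refl

-- With n = m + 1, these are exp(Σ s p_n/n) and exp(Σ (p_n²/2n + a p_n/n)) in factored form.
expLinear expQuadratic : (ℕ → ℚ) → Series
expLinear s    = factored (λ m r → power (s m) r * w m r)
expQuadratic a = factored (λ m → Var.gauss m (a m))

expLinear-logDerivative : ∀ s → IsLogDerivative (expLinear s) (separated (λ m → Var.linear m (s m)))
expLinear-logDerivative s = logDerivative-factored (λ m → Var.linear-logDerivative m (s m))

expQuadratic-logDerivative : ∀ a → IsLogDerivative (expQuadratic a) (separated (λ m → Var.quadratic m (a m)))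
expQuadratic-logDerivative a = logDerivative-factored (λ m → Var.gauss-logDerivative m (a m))

expLinear-cong : ∀ {s t} → (∀ m → s m ≡ t m) → expLinear s ≈ expLinear t
expLinear-cong eq = factored-cong (λ m r → cong (λ x → power x r * w m r) (eq m))

expQuadratic-cong : ∀ {a b} → (∀ m → a m ≡ b m) → expQuadratic a ≈ expQuadratic b
expQuadratic-cong eq = factored-cong (λ m r → cong (λ x → Var.gauss m x r) (eq m))

expLinear-⊗-expLinear : ∀ {f g s t} → f ≈ expLinear s → g ≈ expLinear t → f ⊗ g ≈ expLinear (λ m → s m * t m)
expLinear-⊗-expLinear {s = s} {t} f≈ g≈ = ⊗-factored (λ m r → power (s m * t m) r * w m r) f≈ g≈ (λ m r →
  trans (z-w-w m r (power (s m) r) (power (t m) r)) (cong (_* w m r) (power-* (s m) (t m) r)))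

-- Kronecker multiplication by exp(Σ s p_n/n) substitutes s p_n for p_n; as s² = 1, only the linear
-- coefficients change.
expLinear-⊗-expQuadratic : ∀ {f g s a} → (∀ m → s m * s m ≡ 1ℚ) → f ≈ expLinear s → g ≈ expQuadratic a →
  f ⊗ g ≈ expQuadratic (λ m → s m * a m)
expLinear-⊗-expQuadratic {s = s} {a} s² f≈ g≈ = ⊗-factored (λ m → Var.gauss m (s m * a m)) f≈ g≈ (λ m r →
  trans (z-w-w m r (power (s m) r) (Var.hermite m (a m) r))
    (cong (_* w m r) (Var.hermite-sign m (s m) (s² m) (a m) r)))

η : ℕ → ℚ
η m = recip (2 ℕ.* suc m)

η+η≡ν : ∀ m → η m + η m ≡ recip (suc m)
η+η≡ν m = trans (cong (λ x → x + x) (recip-* 2 (suc m)))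
  (solve 1 (λ ν → con (recip 2) :* ν :+ con (recip 2) :* ν := ν) refl (recip (suc m)))
  where open +-*-Solver

mehlerExponents : (ℕ → ℚ) → (ℕ → ℚ) → ℕ → ℕ → ℚ
mehlerExponents a b m = Var.mehlerExponent m (η m) (a m) (b m)

-- The logarithmic derivative in Mehler's formula has two summands: `χ₀` belongs to `G`, the rest to
-- `M`.
expQuadratic-⊗-expQuadratic : ∀ {f g M} a b → f ≈ expQuadratic a → g ≈ expQuadratic b →
  IsLogDerivative M (separated (θ ∘ mehlerExponents a b)) → f ⊗ g ≈ G *S M
expQuadratic-⊗-expQuadratic {f} {g} {M} a b f≈ g≈ M-log r = begin
  (f ⊗ g) r      ≡⟨ ⊗-factored U f≈ g≈ (λ m r → z-w-w m r (Var.hermite m (a m) r) (Var.hermite m (b m) r)) r ⟩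
  factored U r   ≡⟨ logDerivative-unique {factored U} {G ⊛ M} U-log (logDerivative-⊛ G-logDerivative M-log)
                      (sym ∘ separated-⊕ (λ _ → χ₀) (θ ∘ mehlerExponents a b)) r ⟩
  (G ⊛ M) r      ≡⟨ *S≈⊛ G M r ⟨
  (G *S M) r     ∎
  where
  U : ℕ → ℕ → ℚ
  U m = Var.Mehler.U m (η m) (η+η≡ν m) (a m) (b m)
  U-log : IsLogDerivative (factored U) (separated (λ m → Var.Mehler.χ m (η m) (η+η≡ν m) (a m) (b m)))
  U-log = logDerivative-factored (λ m → Var.Mehler.mehler m (η m) (η+η≡ν m) (a m) (b m))

-- The series H, E, S and the quotients of S

-- The index m stands for p_n with n = m + 1, hence the `suc`: `x` is the value for odd n, `y` for
-- even n.
parity : ℚ → ℚ → ℕ → ℚ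
parity x y m = if odd (suc m) then x else y

parity-* : ∀ x y x′ y′ m → parity x y m * parity x′ y′ m ≡ parity (x * x′) (y * y′) m
parity-* x y x′ y′ m with odd (suc m)
... | true  = refl
... | false = refl

parity-+-1 : ∀ x y m → parity x y m + 1ℚ ≡ parity (x + 1ℚ) (y + 1ℚ) m
parity-+-1 x y m with odd (suc m)
... | true  = refl
... | false = refl

parity-+ : ∀ x y x′ y′ m → parity x y m + parity x′ y′ m ≡ parity (x + x′) (y + y′) m
parity-+ x y x′ y′ m with odd (suc m)
... | true  = refl
... | false = refl

sign : ℕ → ℚ
sign = parity 1ℚ (- 1ℚ)

sign² : ∀ m → sign m * sign m ≡ 1ℚ
sign² m with odd (suc m)
... | true  = refl
... | false = refl

linearExponent : (ℕ → ℚ) → ℕ → ℕ → ℚ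
linearExponent s m a = s m * recip (suc m) * monomial 1 a

linearExponent-zero : ∀ s m → linearExponent s m 0 ≡ 0ℚ
linearExponent-zero s m = *-zeroʳ (s m * recip (suc m))

θ-linearExponent : ∀ s m a → θ (linearExponent s m) a ≡ Var.linear m (s m) a
θ-linearExponent s m zero          = *-zeroˡ (linearExponent s m 0)
θ-linearExponent s m (suc zero)    = trans (*-identityˡ (linearExponent s m 1)) (*-identityʳ (s m * recip (suc m)))
θ-linearExponent s m (suc (suc a)) =
  trans (cong (fromℕ (2 ℕ.+ a) *_) (linearExponent-zero s m)) (*-zeroʳ (fromℕ (2 ℕ.+ a)))

linearExponential : ∀ F s → (∀ m → F (suc m) ≈ scaleS (s m * recip (suc m)) (p (suc m))) →
  IsLogDerivative (expS (sumS F)) (separated (λ m → Var.linear m (s m)))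
linearExponential F s F≈ = logDerivative-cong {expS (sumS F)} {expS (sumS F)} {separated (θ ∘ linearExponent s)}
  (λ _ → refl) (separated-cong (θ-linearExponent s))
  (expS-logDerivative (linearExponent s)
    (sumS≈separated F (linearExponent s) F≈φ (linearExponent-zero s)) (linearExponent-zero s))
  where
  F≈φ : ∀ m → F (suc m) ≈ inVar m (linearExponent s m)
  F≈φ m r = trans (F≈ m r) (scaleS≈inVar m (s m * recip (suc m))
    {p (suc m)} {monomial 1} {linearExponent s m} (p≈inVar m) (λ _ → refl) r)

H-logDerivative : IsLogDerivative H (separated (λ m → Var.linear m 1ℚ))
H-logDerivative = linearExponential (λ n → scaleS (recip n) (p n)) (λ _ → 1ℚ)
  (λ m r → cong (_* p (suc m) r) (sym (*-identityˡ (recip (suc m)))))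

E-logDerivative : IsLogDerivative E (separated (λ m → Var.linear m (sign m)))
E-logDerivative = linearExponential
  (λ n → scaleS ((if odd n then 1ℚ else - 1ℚ) * recip n) (p n)) sign (λ _ _ → refl)

H≈expLinear : H ≈ expLinear (λ _ → 1ℚ)
H≈expLinear = logDerivative-unique H-logDerivative (expLinear-logDerivative (λ _ → 1ℚ)) (λ _ → refl)

E≈expLinear : E ≈ expLinear sign
E≈expLinear = logDerivative-unique E-logDerivative (expLinear-logDerivative sign) (λ _ → refl)

Σ<-double : ∀ n (f : ℕ → ℚ) → Σ< n (λ m → f (double m)) ≡ Σ< (double n) (λ j → if odd (suc j) then f j else 0ℚ)
Σ<-double zero    f = refl
Σ<-double (suc n) f = cong (f 0 +_) (trans (Σ<-double n (λ j → f (2 ℕ.+ j)))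
  (sym (+-identityˡ (Σ< (double n) (λ j → if odd (suc j) then f (2 ℕ.+ j) else 0ℚ)))))

n≤double : ∀ n → n ≤ double n
n≤double zero    = z≤n
n≤double (suc n) = ℕ.≤-trans (s≤s (n≤double n)) (ℕ.n≤1+n (suc (double n)))

-- The exponent of `S` runs over p_1, p_3, p_5, ...; padding with zeros at the even variables makes
-- it a sum over the first 2n variables, more than the weight of `r` requires.
oddSum≈separated : ∀ (c : ℕ → ℚ) n r → wdeg r < suc (double n) →
  Σ< n (λ m → c (double m) * p (suc (double m)) r) ≡ separated (λ m a → parity (c m) 0ℚ m * monomial 1 a) r
oddSum≈separated c n r lt = begin
  Σ< n (λ m → c (double m) * p (suc (double m)) r)
    ≡⟨ Σ<-double n (λ j → c j * p (suc j) r) ⟩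
  Σ< (double n) (λ j → if odd (suc j) then c j * p (suc j) r else 0ℚ)
    ≡⟨ Σ<-cong (double n) (λ j → inVariable j (odd (suc j))) ⟩
  Σ< (double n) (λ j → inVar j (φ j) r)
    ≡⟨ Σ<-inVar (double n) 0 φ (λ m → *-zeroʳ (parity (c m) 0ℚ m)) r lt ⟩
  separated φ r ∎
  where
  φ : ℕ → ℕ → ℚ
  φ m a = parity (c m) 0ℚ m * monomial 1 a
  scaled : ∀ j x → x * p (suc j) r ≡ inVar j (λ a → x * monomial 1 a) r
  scaled j x = scaleS≈inVar j x {p (suc j)} {monomial 1} {λ a → x * monomial 1 a} (p≈inVar j) (λ _ → refl) r
  -- The parity is generalized to a Boolean `b`, so that both conditionals reduce in each case.
  inVariable : ∀ j b → (if b then c j * p (suc j) r else 0ℚ) ≡ inVar j (λ a → (if b then c j else 0ℚ) * monomial 1 a) r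
  inVariable j true  = scaled j (c j)
  inVariable j false = trans (sym (*-zeroˡ (p (suc j) r))) (scaled j 0ℚ)

squareTerm oddTerm : ℕ → Series
squareTerm n = scaleS (recip (2 ℕ.* n)) (powS (p n) 2)
oddTerm n    = scaleS (recip (2 ℕ.* n ∸ 1)) (p (2 ℕ.* n ∸ 1))

squareExponent oddExponent : ℕ → ℕ → ℚ
squareExponent m a = η m * monomial 2 a
oddExponent m a = parity (recip (suc m)) 0ℚ m * monomial 1 a

oddExponent-zero : ∀ m → oddExponent m 0 ≡ 0ℚ
oddExponent-zero m = *-zeroʳ (parity (recip (suc m)) 0ℚ m)

oddTerm-suc : ∀ m r → oddTerm (suc m) r ≡ recip (suc (double m)) * p (suc (double m)) r
oddTerm-suc m r = cong (λ j → scaleS (recip j) (p j) r)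
  (trans (ℕ.+-suc m (m ℕ.+ 0)) (cong suc (sym (double≡2* m))))

sumS-oddTerm : sumS oddTerm ≈ separated oddExponent
sumS-oddTerm r = trans (sum1To≡Σ< (wdeg r) (λ k → oddTerm k r))
  (trans (Σ<-cong (wdeg r) (λ m → oddTerm-suc m r))
    (oddSum≈separated (λ j → recip (suc j)) (wdeg r) r (s≤s (n≤double (wdeg r)))))

squareExponent-zero : ∀ m → squareExponent m 0 ≡ 0ℚ
squareExponent-zero m = *-zeroʳ (η m)

sumS-squareTerm : sumS squareTerm ≈ separated squareExponent
sumS-squareTerm = sumS≈separated squareTerm squareExponent
  (λ m → scaleS≈inVar m (η m) {powS (p (suc m)) 2} {monomial 2} {squareExponent m} (powS-p≈inVar m 2) (λ _ → refl))
  squareExponent-zero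

quadraticExponent : ℕ → ℕ → ℚ
quadraticExponent m a = squareExponent m a + oddExponent m a

quadraticExponent-zero : ∀ m → quadraticExponent m 0 ≡ 0ℚ
quadraticExponent-zero m = cong₂ _+_ (squareExponent-zero m) (oddExponent-zero m)

sumS-quadratic : sumS (λ n → squareTerm n +S oddTerm n) ≈ separated quadraticExponent
sumS-quadratic r = begin
  sum1To n (λ k → squareTerm k r + oddTerm k r)
    ≡⟨ sum1To≡Σ< n (λ k → squareTerm k r + oddTerm k r) ⟩
  Σ< n (λ m → squareTerm (suc m) r + oddTerm (suc m) r)
    ≡⟨ Σ<-+ n {λ m → squareTerm (suc m) r} {λ m → oddTerm (suc m) r} ⟩
  Σ< n (λ m → squareTerm (suc m) r) + Σ< n (λ m → oddTerm (suc m) r)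
    ≡⟨ cong₂ _+_ (sum1To≡Σ< n (λ k → squareTerm k r)) (sum1To≡Σ< n (λ k → oddTerm k r)) ⟨
  sumS squareTerm r + sumS oddTerm r
    ≡⟨ cong₂ _+_ (sumS-squareTerm r) (sumS-oddTerm r) ⟩
  separated squareExponent r + separated oddExponent r
    ≡⟨ separated-⊕ squareExponent oddExponent r ⟩
  separated quadraticExponent r ∎
  where n = wdeg r

parity-*ʳ : ∀ x y z m → parity (x * z) (y * z) m ≡ parity x y m * z
parity-*ʳ x y z m with odd (suc m)
... | true  = refl
... | false = refl

parity-recip : ∀ m → parity (recip (suc m)) 0ℚ m ≡ parity 1ℚ 0ℚ m * recip (suc m)
parity-recip m = trans
  (sym (cong₂ (λ x y → parity x y m) (*-identityˡ (recip (suc m))) (*-zeroˡ (recip (suc m)))))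
  (parity-*ʳ 1ℚ 0ℚ (recip (suc m)) m)

θ-quadraticExponent : ∀ m a → θ (quadraticExponent m) a ≡ Var.quadratic m (parity 1ℚ 0ℚ m) a
θ-quadraticExponent m a = by-degree (η m) (parity (recip (suc m)) 0ℚ m) a
  (parity-recip m) (η+η≡ν m)
  where
  open +-*-Solver
  -- The fractions become variables `h` and `x`, which the solver treats as atoms; their values
  -- enter through the two equations.
  by-degree : ∀ h x a → x ≡ parity 1ℚ 0ℚ m * recip (suc m) → h + h ≡ recip (suc m) →
    fromℕ a * (h * monomial 2 a + x * monomial 1 a) ≡ Var.quadratic m (parity 1ℚ 0ℚ m) a
  by-degree h x zero                _  _  = *-zeroˡ (h * 0ℚ + x * 0ℚ)
  by-degree h x (suc zero)          xe _  =
    trans (solve 2 (λ h x → con 1ℚ :* (h :* con 0ℚ :+ x :* con 1ℚ) := x) refl h x) xe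
  by-degree h x (suc (suc zero))    _  he =
    trans (solve 2 (λ h x → con (fromℕ 2) :* (h :* con 1ℚ :+ x :* con 0ℚ) := h :+ h) refl h x) he
  by-degree h x (suc (suc (suc a))) _  _  =
    solve 3 (λ n h x → n :* (h :* con 0ℚ :+ x :* con 0ℚ) := con 0ℚ) refl (fromℕ (3 ℕ.+ a)) h x

S-logDerivative : IsLogDerivative S (separated (λ m → Var.quadratic m (parity 1ℚ 0ℚ m)))
S-logDerivative = logDerivative-cong {S} {S} {separated (θ ∘ quadraticExponent)}
  (λ _ → refl) (separated-cong θ-quadraticExponent)
  (expS-logDerivative quadraticExponent sumS-quadratic quadraticExponent-zero)

S≈expQuadratic : S ≈ expQuadratic (parity 1ℚ 0ℚ)
S≈expQuadratic = logDerivative-unique S-logDerivative (expQuadratic-logDerivative (parity 1ℚ 0ℚ)) (λ _ → refl)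

quadratic-+-linear : ∀ m a s t k → a + s ≡ t → Var.quadratic m a k + Var.linear m s k ≡ Var.quadratic m t k
quadratic-+-linear m a s _ k refl = Var.quadratic-linear m a s k

quadratic-⊕-linear : ∀ (a s t : ℕ → ℚ) → (∀ m → a m + s m ≡ t m) →
  separated (λ m → Var.quadratic m (a m)) ⊕ separated (λ m → Var.linear m (s m)) ≈ separated (λ m → Var.quadratic m (t m))
quadratic-⊕-linear a s t eq r = trans
  (separated-⊕ (λ m → Var.quadratic m (a m)) (λ m → Var.linear m (s m)) r)
  (separated-cong (λ m k → quadratic-+-linear m (a m) (s m) (t m) k (eq m)) r)

-- Dividing by exp(Σ s p_n/n) subtracts s from the linear coefficients of `S`, which are 1 for odd n
-- and 0 for even n. For `H` this leaves 0 and -1, for `E` it leaves 0 and 1.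
S-quotient : ∀ {g} (a s : ℕ → ℚ) → IsLogDerivative g (separated (λ m → Var.linear m (s m))) →
  (∀ m → a m + s m ≡ parity 1ℚ 0ℚ m) → S *S invS g ≈ expQuadratic a
S-quotient {g} a s g-log a+s = *S-invS-unique {S} {g} (expQuadratic a)
  (logDerivative-unique {expQuadratic a ⊛ g} {S}
    {separated (λ m → Var.quadratic m (a m)) ⊕ separated (λ m → Var.linear m (s m))}
    {separated (λ m → Var.quadratic m (parity 1ℚ 0ℚ m))}
    (logDerivative-⊛ (expQuadratic-logDerivative a) g-log) S-logDerivative
    (quadratic-⊕-linear a s (parity 1ℚ 0ℚ) a+s))
  (IsLogDerivative.unital g-log)

SH⁻¹≈expQuadratic : SH⁻¹ ≈ expQuadratic (parity 0ℚ (- 1ℚ))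
SH⁻¹≈expQuadratic = S-quotient {H} (parity 0ℚ (- 1ℚ)) (λ _ → 1ℚ) H-logDerivative (parity-+-1 0ℚ (- 1ℚ))

SE⁻¹≈expQuadratic : SE⁻¹ ≈ expQuadratic (parity 0ℚ 1ℚ)
SE⁻¹≈expQuadratic = S-quotient {E} (parity 0ℚ 1ℚ) sign E-logDerivative (parity-+ 0ℚ 1ℚ 1ℚ (- 1ℚ))

-- The right-hand sides as cases of Mehler's exponent

delayed-cong : ∀ {x y x′ y′ : ℚ} → x ≡ x′ → y ≡ y′ → ∀ a → delayed x y a ≡ delayed x′ y′ a
delayed-cong refl refl a = refl

delayed-zero : ∀ {x y} → x ≡ 0ℚ → y ≡ 0ℚ → ∀ a → delayed x y a ≡ 0ℚ
delayed-zero refl refl a = trans (sym (delayed-* 0ℚ 0ℚ 0ℚ a)) (*-zeroˡ (delayed 0ℚ 0ℚ a))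

half-sum : ∀ m {c} → c ≡ 1ℚ + 1ℚ → c * η m ≡ recip (suc m)
half-sum m refl = trans (solve 1 (λ h → con (1ℚ + 1ℚ) :* h := h :+ h) refl (η m)) (η+η≡ν m)
  where open +-*-Solver

mehlerExponent-zero : ∀ m → zeroS ≈ inVar m (Var.mehlerExponent m (η m) 0ℚ 0ℚ)
mehlerExponent-zero m = zeroS≈inVar m (delayed-zero (*-zeroˡ (recip (suc m))) (*-zeroˡ (η m)))

-- For a = b and a² = 1 the exponent is (t + t²)/(n (1-t²)) = t/(n (1-t)).
mehlerExponent-diagonal : ∀ m x → x * x ≡ 1ℚ → pTerm (suc m) ≈ inVar m (Var.mehlerExponent m (η m) x x)
mehlerExponent-diagonal m x x² = scaleS≈inVar m ν (p/[1-p] m) (λ a →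
  trans (delayed-* ν 1ℚ 1ℚ a) (delayed-cong
    (trans (*-comm ν 1ℚ) (cong (_* ν) (sym x²)))
    (trans (*-identityʳ ν) (sym (half-sum m (cong₂ _+_ x² x²)))) a))
  where ν = recip (suc m)

-- For a b = 0 and a² + b² = 1 only t²/(2n (1-t²)) remains.
mehlerExponent-orthogonal : ∀ m x y → x * y ≡ 0ℚ → x * x + y * y ≡ 1ℚ →
  scaleS (η m) (powS (p (suc m)) 2 *S geomInv (powS (p (suc m)) 2)) ≈ inVar m (Var.mehlerExponent m (η m) x y)
mehlerExponent-orthogonal m x y xy x²+y² = scaleS≈inVar m (η m) (p²/[1-p²] m) (λ a →
  trans (delayed-* (η m) 0ℚ 1ℚ a) (delayed-cong
    (trans (*-zeroʳ (η m)) (sym (trans (cong (_* recip (suc m)) xy) (*-zeroˡ (recip (suc m))))))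
    (trans (*-comm (η m) 1ℚ) (cong (_* η m) (sym x²+y²))) a))

mehlerSum-logDerivative : ∀ F (a b : ℕ → ℚ) → (∀ m → F (suc m) ≈ inVar m (mehlerExponents a b m)) →
  IsLogDerivative (expS (sumS F)) (separated (θ ∘ mehlerExponents a b))
mehlerSum-logDerivative F a b eq = expS-logDerivative (mehlerExponents a b)
  (sumS≈separated F (mehlerExponents a b) eq (λ _ → refl)) (λ _ → refl)

Modd-logDerivative : IsLogDerivative Modd (separated (θ ∘ mehlerExponents (parity 1ℚ 0ℚ) (parity 1ℚ 0ℚ)))
Modd-logDerivative = mehlerSum-logDerivative (λ n → if odd n then pTerm n else zeroS)
  (parity 1ℚ 0ℚ) (parity 1ℚ 0ℚ) (λ m → term m (odd (suc m)))
  where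
  term : ∀ m b → (if b then pTerm (suc m) else zeroS) ≈
    inVar m (Var.mehlerExponent m (η m) (if b then 1ℚ else 0ℚ) (if b then 1ℚ else 0ℚ))
  term m true  = mehlerExponent-diagonal m 1ℚ refl
  term m false = mehlerExponent-zero m

-- Only x² enters, so x = -1 and x = 1 serve the squares of `SH⁻¹` and of `SE⁻¹` with the same
-- result.
Meven-logDerivative : ∀ x → x * x ≡ 1ℚ → IsLogDerivative Meven (separated (θ ∘ mehlerExponents (parity 0ℚ x) (parity 0ℚ x)))
Meven-logDerivative x x² = mehlerSum-logDerivative (λ n → if even n then pTerm n else zeroS)
  (parity 0ℚ x) (parity 0ℚ x) (λ m → term m (odd (suc m)))
  where
  term : ∀ m b → (if (if b then false else true) then pTerm (suc m) else zeroS) ≈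
    inVar m (Var.mehlerExponent m (η m) (if b then 0ℚ else x) (if b then 0ℚ else x))
  term m true  = mehlerExponent-zero m
  term m false = mehlerExponent-diagonal m x x²

N-logDerivative : ∀ x → x * x ≡ 1ℚ → IsLogDerivative N (separated (θ ∘ mehlerExponents (parity 1ℚ 0ℚ) (parity 0ℚ x)))
N-logDerivative x x² = mehlerSum-logDerivative
  (λ n → scaleS (recip (2 ℕ.* n)) (powS (p n) 2 *S geomInv (powS (p n) 2)))
  (parity 1ℚ 0ℚ) (parity 0ℚ x) (λ m → term m (odd (suc m)))
  where
  term : ∀ m b → scaleS (η m) (powS (p (suc m)) 2 *S geomInv (powS (p (suc m)) 2)) ≈
    inVar m (Var.mehlerExponent m (η m) (if b then 1ℚ else 0ℚ) (if b then 0ℚ else x))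
  term m true  = mehlerExponent-orthogonal m 1ℚ 0ℚ refl refl
  term m false = mehlerExponent-orthogonal m 0ℚ x (*-zeroˡ x) (trans (+-identityˡ (x * x)) x²)

-- The products with `1ℚ` and `- 1ℚ` are left standing to match the form that `delayed-*` produces.
evenExponent : ℚ → Bool → ℕ → ℚ
evenExponent ν b = delayed ((if b then 0ℚ else ν) * 1ℚ) ((if b then 0ℚ else ν) * - 1ℚ)

PTerm≈inVar : ∀ m b →
  (if (if b then false else true) then scaleS (recip (suc m)) (p (suc m) *S invS (oneS +S p (suc m))) else zeroS) ≈
  inVar m (evenExponent (recip (suc m)) b)
PTerm≈inVar m true  = zeroS≈inVar m (delayed-zero refl refl)
PTerm≈inVar m false = scaleS≈inVar m (recip (suc m)) (p/[1+p] m) (delayed-* (recip (suc m)) 1ℚ (- 1ℚ))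

-- At even n, where a = -1 and b = 1, the exponent is (-t + t²)/(n (1-t²)) = -t/(n (1+t)); at odd n
-- both coefficients are 0.
negate-evenExponent : ∀ m b a → - 1ℚ * evenExponent (recip (suc m)) b a ≡
  Var.mehlerExponent m (η m) (if b then 0ℚ else - 1ℚ) (if b then 0ℚ else 1ℚ) a
negate-evenExponent m true  a = trans (delayed-* (- 1ℚ) (0ℚ * 1ℚ) (0ℚ * - 1ℚ) a)
  (delayed-cong (sym (*-zeroˡ (recip (suc m)))) (sym (*-zeroˡ (η m))) a)
negate-evenExponent m false a = trans (delayed-* (- 1ℚ) (ν * 1ℚ) (ν * - 1ℚ) a) (delayed-cong
  (solve 1 (λ ν → con (- 1ℚ) :* (ν :* con 1ℚ) := con (- 1ℚ) :* ν) refl ν)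
  (trans (solve 1 (λ ν → con (- 1ℚ) :* (ν :* con (- 1ℚ)) := ν) refl ν) (sym (half-sum m refl))) a)
  where
  open +-*-Solver
  ν = recip (suc m)

P-logDerivative : IsLogDerivative P (separated (θ ∘ mehlerExponents (parity 0ℚ (- 1ℚ)) (parity 0ℚ 1ℚ)))
P-logDerivative = expS-logDerivative (mehlerExponents (parity 0ℚ (- 1ℚ)) (parity 0ℚ 1ℚ)) negated (λ _ → refl)
  where
  F : ℕ → Series
  F n = if even n then scaleS (recip n) (p n *S invS (oneS +S p n)) else zeroS
  ψ : ℕ → ℕ → ℚ
  ψ m = evenExponent (recip (suc m)) (odd (suc m))
  negated : negS (sumS F) ≈ separated (mehlerExponents (parity 0ℚ (- 1ℚ)) (parity 0ℚ 1ℚ))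
  negated r = begin
    -- The negation is rewritten as multiplication by -1, since `separated-*ˡ` handles scalar
    -- factors.
    - sumS F r                         ≡⟨ cong -_ (*-identityˡ (sumS F r)) ⟨
    - (1ℚ * sumS F r)                  ≡⟨ neg-distribˡ-* 1ℚ (sumS F r) ⟩
    - 1ℚ * sumS F r                    ≡⟨ cong (- 1ℚ *_) (sumS≈separated F ψ (λ m → PTerm≈inVar m (odd (suc m))) (λ _ → refl) r) ⟩
    - 1ℚ * separated ψ r               ≡⟨ separated-*ˡ (- 1ℚ) ψ r ⟩
    separated (λ m a → - 1ℚ * ψ m a) r ≡⟨ separated-cong (λ m → negate-evenExponent m (odd (suc m))) r ⟩
    separated (mehlerExponents (parity 0ℚ (- 1ℚ)) (parity 0ℚ 1ℚ)) r ∎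

-- The table of Kronecker products

H⊗expQuadratic : ∀ {f} (a : ℕ → ℚ) → f ≈ expQuadratic a → H ⊗ f ≈ f
H⊗expQuadratic {f} a f≈ r = trans
  (expLinear-⊗-expQuadratic {H} {f} {λ _ → 1ℚ} {a} (λ _ → refl) H≈expLinear f≈ r)
  (trans (expQuadratic-cong (λ m → *-identityˡ (a m)) r) (sym (f≈ r)))

-- `E` reverses the linear coefficients at even n only. Those of `S` vanish there, so `S` is fixed,
-- while `SH⁻¹` and `SE⁻¹` are exchanged.
E⊗expQuadratic : ∀ {f g} x y → f ≈ expQuadratic (parity x y) → g ≈ expQuadratic (parity (1ℚ * x) (- 1ℚ * y)) →
  E ⊗ f ≈ g
E⊗expQuadratic {f} {g} x y f≈ g≈ r = trans
  (expLinear-⊗-expQuadratic {E} {f} {sign} {parity x y} sign² E≈expLinear f≈ r)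
  (trans (expQuadratic-cong (parity-* 1ℚ (- 1ℚ) x y) r) (sym (g≈ r)))

theorem1 : ((H ⊗ H ≈S H) × (H ⊗ E ≈S E) × (H ⊗ S ≈S S) × (H ⊗ SH⁻¹ ≈S SH⁻¹) × (H ⊗ SE⁻¹ ≈S SE⁻¹))
    × ((E ⊗ E ≈S H) × (E ⊗ S ≈S S) × (E ⊗ SH⁻¹ ≈S SE⁻¹) × (E ⊗ SE⁻¹ ≈S SH⁻¹))
    × ((S ⊗ S ≈S G *S Modd) × (S ⊗ SH⁻¹ ≈S G *S N) × (S ⊗ SE⁻¹ ≈S G *S N))
    × ((SH⁻¹ ⊗ SH⁻¹ ≈S G *S Meven) × (SH⁻¹ ⊗ SE⁻¹ ≈S G *S P) × (SE⁻¹ ⊗ SE⁻¹ ≈S G *S Meven))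
theorem1 =
  ( (λ r → trans (expLinear-⊗-expLinear {H} {H} H≈expLinear H≈expLinear r) (sym (H≈expLinear r)))
  , (λ r → trans (expLinear-⊗-expLinear {H} {E} H≈expLinear E≈expLinear r)
             (trans (expLinear-cong (λ m → *-identityˡ (sign m)) r) (sym (E≈expLinear r))))
  , H⊗expQuadratic s S≈expQuadratic
  , H⊗expQuadratic sh SH⁻¹≈expQuadratic
  , H⊗expQuadratic se SE⁻¹≈expQuadratic
  ) ,
  ( (λ r → trans (expLinear-⊗-expLinear {E} {E} E≈expLinear E≈expLinear r)
             (trans (expLinear-cong sign² r) (sym (H≈expLinear r))))
  , E⊗expQuadratic 1ℚ 0ℚ S≈expQuadratic S≈expQuadratic
  , E⊗expQuadratic 0ℚ (- 1ℚ) SH⁻¹≈expQuadratic SE⁻¹≈expQuadratic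
  , E⊗expQuadratic 0ℚ 1ℚ SE⁻¹≈expQuadratic SH⁻¹≈expQuadratic
  ) ,
  ( expQuadratic-⊗-expQuadratic s s S≈expQuadratic S≈expQuadratic Modd-logDerivative
  , expQuadratic-⊗-expQuadratic s sh S≈expQuadratic SH⁻¹≈expQuadratic (N-logDerivative (- 1ℚ) refl)
  , expQuadratic-⊗-expQuadratic s se S≈expQuadratic SE⁻¹≈expQuadratic (N-logDerivative 1ℚ refl)
  ) ,
  ( expQuadratic-⊗-expQuadratic sh sh SH⁻¹≈expQuadratic SH⁻¹≈expQuadratic (Meven-logDerivative (- 1ℚ) refl)
  , expQuadratic-⊗-expQuadratic sh se SH⁻¹≈expQuadratic SE⁻¹≈expQuadratic P-logDerivative
  , expQuadratic-⊗-expQuadratic se se SE⁻¹≈expQuadratic SE⁻¹≈expQuadratic (Meven-logDerivative 1ℚ refl)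
  )
  where
  s sh se : ℕ → ℚ
  s  = parity 1ℚ 0ℚ
  sh = parity 0ℚ (- 1ℚ)
  se = parity 0ℚ 1ℚ
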